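{- Let $n$ and $k$ be positive integers and let $x$ be an integer. If a family $F$ of subsets of $[n]=\{1,\dots,n\}$ satisfies $|F| = x + \Sigma(n,k-1)$, then there are at least $$x\cdot\prod_{i=1}^{k-1}\left(\left\lfloor\frac{n+k}{2}\right\rfloor-i+1\right)$$ copies of $\mathcal{P}_k$ in $F$, that is, at least this many $k$-chains $A_1\subsetneq A_2\subsetneq\dots\subsetneq A_k$ with $A_1,\dots,A_k\in F$.
   Context: For a set $S$, $\binom{S}{j}$ denotes the collection of all $j$-element subsets of $S$ (empty if $j<0$ or $j>|S|$). For an integer $m\ge 0$, $\mathcal{B}(n,m)$ denotes a family of all subsets of $[n]$ of the $m$ middle sizes, i.e. either $$\mathcal{B}(n,m)=\binom{[n]}{\lfloor (n-m+1)/2\rfloor}\cup\cdots\cup\binom{[n]}{\lfloor (n+m-1)/2\rfloor}$$ or $$\mathcal{B}(n,m)=\binom{[n]}{\lceil (n-m+1)/2\rceil}\cup\cdots\cup\binom{[n]}{\lceil (n+m-1)/2\rceil}.$$ (Depending on the parity of $n$ and $m$, these are one or two different families; they have the same size. For $m=0$ the family is empty.) $\Sigma(n,m)=|\mathcal{B}(n,m)|$ denotes the common size, i.e. the sum of the $m$ middle binomial coefficients $\binom{n}{j}$; in particular $\Sigma(n,0)=0$. $\mathcal{P}_k$ denotes the $k$-element totally ordered set (chain). Families of subsets are ordered by inclusion, and a copy of $\mathcal{P}_k$ in $F$ is a set of $k$ members of $F$ that is totally ordered by inclusion. An empty product equals $1$. -}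

module Defs where

open import Data.Nat.Base as ℕ using (ℕ; zero; suc)
open import Data.Integer.Base using (ℤ; +_; 1ℤ; _+_; _-_; _*_; _/ℕ_)
open import Data.Integer.Properties using (_≤?_)
open import Data.Fin.Subset using (Subset; inside; outside; ∣_∣)
open import Data.Fin.Subset.Properties using (_⊂?_)
open import Data.List.Base using (List; []; _∷_; _++_; map; filter; length; cartesianProductWith)
open import Data.Vec.Base as Vec using (Vec)
open import Data.Vec.Relation.Unary.Linked using (linked?)
open import Relation.Nullary.Decidable using (_×-dec_)

allSubsets : ∀ n → List (Subset n)
allSubsets zero    = Vec.[] ∷ []
allSubsets (suc n) = map (outside Vec.∷_) (allSubsets n) ++ map (inside Vec.∷_) (allSubsets n)

-- _/ℕ_ rounds towards -∞, so these are the integers ⌊(n-m+1)/2⌋ and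
-- ⌊(n+m-1)/2⌋; the first is negative when m > n + 1.
lowestMiddle highestMiddle : ℕ → ℕ → ℤ
lowestMiddle  n m = (+ n - + m + 1ℤ) /ℕ 2
highestMiddle n m = (+ n + + m - 1ℤ) /ℕ 2

-- The rounded-down choice of the family 𝓑(n,m); complementation A ↦ [n] ∖ A
-- carries it to the rounded-up one, so Σ(n,m) does not depend on the choice.
𝓑 : ∀ n → ℕ → List (Subset n)
𝓑 n m = filter (λ A → (lowestMiddle n m ≤? + ∣ A ∣) ×-dec (+ ∣ A ∣ ≤? highestMiddle n m)) (allSubsets n)

Σ𝓑 : ℕ → ℕ → ℕ
Σ𝓑 n m = length (𝓑 n m)

tuples : ∀ {a} {A : Set a} k → List A → List (Vec A k)
tuples zero    xs = Vec.[] ∷ []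
tuples (suc k) xs = cartesianProductWith Vec._∷_ xs (tuples k xs)

-- All (A₁ , … , Aₖ) with entries in F and A₁ ⊂ A₂ ⊂ … ⊂ Aₖ, where _⊂_ is strict
-- inclusion. If F has no repetitions, neither does this list, and each copy of
-- 𝓟ₖ in F occurs in it exactly once, listed in increasing order.
chains : ∀ {n} k → List (Subset n) → List (Vec (Subset n) k)
chains k F = filter (linked? _⊂?_) (tuples k F)

∏[1⋯_] : ℕ → (ℕ → ℤ) → ℤ
∏[1⋯ zero  ] f = 1ℤ
∏[1⋯ suc m ] f = ∏[1⋯ m ] f * f (suc m)

{-# OPTIONS --safe #-}
module Submission where

open import Defs
open import Algebra.Properties.CommutativeSemigroup using (interchange; x∙yz≈y∙xz)
open import Data.Bool.Base using (true; false; if_then_else_)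
import Data.Bool.Properties as Bool
open import Data.Fin.Subset using (Subset; inside; outside; ∣_∣; ⊥; _⊆_; _⊂_)
open import Data.Fin.Subset.Properties using (s⊂s; out⊂in; drop-∷-⊆; ∣p∣≤n; p⊂q⇒p⊆q; p⊂q⇒∣p∣<∣q∣; ⊆-refl; ⊂-irref; ⊥⊆; _⊂?_)
import Data.Integer.Base as ℤ
import Data.Integer.Properties as ℤ
import Data.Integer.Tactic.RingSolver as ℤSolver
open import Data.List.Base as List using (List; []; _∷_; _++_; map; filter; length; upTo; applyUpTo; cartesianProductWith)
open import Data.List.Membership.DecPropositional using () renaming (_∈?_ to member?)
open import Data.List.Membership.Propositional using (_∈_; _∉_)
open import Data.List.Membership.Propositional.Properties
open import Data.List.Properties using (map-++; map-∘; upTo-∷ʳ; length-upTo; length-map; map-upTo)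
open import Data.List.Relation.Unary.All as All using (All; []; _∷_)
import Data.List.Relation.Unary.All.Properties as All
open import Data.List.Relation.Unary.AllPairs as AllPairs using (AllPairs; []; _∷_)
import Data.List.Relation.Unary.AllPairs.Properties as AllPairs
open import Data.List.Relation.Unary.Any using (here; there)
open import Data.List.Relation.Unary.Linked as Linked using (Linked; []; [-]; _∷_)
import Data.List.Relation.Unary.Linked.Properties as Linked
open import Data.List.Relation.Unary.Unique.Propositional using (Unique)
import Data.List.Relation.Unary.Unique.Propositional.Properties as Unique
open import Data.Nat.Base
open import Data.Nat.Combinatorics hiding (_P_)
open import Data.Nat.Divisibility using (divides-refl)
open import Data.Nat.DivMod using (_/_; m/n*n≡m; m*n/n≡m; +-distrib-/-∣ˡ; /-mono-≤)
open import Data.Nat.ListAction using (sum)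
open import Data.Nat.ListAction.Properties using (sum-++)
open import Data.Nat.Properties
open import Data.Nat.Tactic.RingSolver using (solve-∀)
open import Data.Product.Base using (_×_; _,_; proj₁; proj₂; ∃; ∃₂)
open import Data.Sum.Base using (inj₁; inj₂)
open import Data.Vec.Base as Vec using (Vec; toList)
import Data.Vec.Properties as Vec
open import Data.Vec.Relation.Unary.All as VAll using ([]; _∷_)
open import Data.Vec.Relation.Unary.All.Properties using (toList⁺)
open import Data.Vec.Relation.Unary.Linked as VLinked using (linked?)
open import Function.Base using (_∘_)
open import Level using (Level)
open import Relation.Binary.Core using (Rel)
open import Relation.Binary.PropositionalEquality
open import Relation.Nullary using (¬_; Dec; does; yes; no; contradiction)
open import Relation.Nullary.Decidable using (dec-true; dec-false; _×-dec_; ¬?)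
open import Relation.Unary using (Pred; Decidable)

-- Let m = k − 1.  Give every A ⊆ [n] the weight n C ∣A∣, so that its weight summed over the maximal chains
-- through it is n!.  On a single maximal chain, for each s below the smallest of the m middle binomial
-- coefficients, the number of members of F of weight > s is at most m plus the number of k-subchains of such
-- members.  Summing over s bounds the weight of F on the chain by Σ(n,m) plus the sum of the minimal weights of
-- the k-subchains.  Summing over all n! maximal chains, a k-chain T of F with sizes a₁ < … < aₖ contributes its
-- minimal weight times the number a₁! (a₂ − a₁)! ⋯ (n − aₖ)! of maximal chains through it.  Unless T contains
-- both ∅ and [n], this contribution times the product of the theorem is at most n!, as one sees by bounding the
-- minimal weight by n C a₁ if a₁ + aₖ ≤ n and by n C aₖ otherwise.  If ∅ ∈ F, apply this to F ∖ {∅} for both k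
-- and k − 1: each (k−1)-chain of F ∖ {∅} extends by ∅, which makes up for the lost element.

private
  variable
    ℓ ℓ′ : Level
    A X Y : Set ℓ
    P : Set ℓ
    Q : Set ℓ′
    R : Rel A ℓ
    n : ℕ

-- Finite sums

∑ : List A → (A → ℕ) → ℕ
∑ xs f = sum (map f xs)

⟦_⟧ : Dec P → ℕ
⟦ P? ⟧ = if does P? then 1 else 0

⟦⟧-mono : (P? : Dec P) (Q? : Dec Q) → (P → Q) → ⟦ P? ⟧ ≤ ⟦ Q? ⟧
⟦⟧-mono (yes _) (yes _) _ = ≤-refl
⟦⟧-mono (yes p) (no ¬q) f = contradiction (f p) ¬q
⟦⟧-mono (no _)  _       _ = z≤n

⟦⟧-≤1 : (P? : Dec P) → ⟦ P? ⟧ ≤ 1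
⟦⟧-≤1 (yes _) = ≤-refl
⟦⟧-≤1 (no _)  = z≤n

⟦⟧-× : (P? : Dec P) (Q? : Dec Q) → ⟦ P? ×-dec Q? ⟧ ≡ ⟦ P? ⟧ * ⟦ Q? ⟧
⟦⟧-× (yes _) (yes _) = refl
⟦⟧-× (yes _) (no _)  = refl
⟦⟧-× (no _)  _       = refl

⟦⟧-true : (P? : Dec P) → P → ⟦ P? ⟧ ≡ 1
⟦⟧-true (yes _) _ = refl
⟦⟧-true (no ¬p) p = contradiction p ¬p

⟦⟧-false : (P? : Dec P) → ¬ P → ⟦ P? ⟧ ≡ 0
⟦⟧-false (yes p) ¬p = contradiction p ¬p
⟦⟧-false (no _)  _  = refl

∑-mono : ∀ (xs : List A) {f g} → (∀ {x} → x ∈ xs → f x ≤ g x) → ∑ xs f ≤ ∑ xs g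
∑-mono []       _ = z≤n
∑-mono (x ∷ xs) h = +-mono-≤ (h (here refl)) (∑-mono xs (h ∘ there))

∑-cong : ∀ (xs : List A) {f g} → (∀ {x} → x ∈ xs → f x ≡ g x) → ∑ xs f ≡ ∑ xs g
∑-cong []       _ = refl
∑-cong (x ∷ xs) h = cong₂ _+_ (h (here refl)) (∑-cong xs (h ∘ there))

∑-++ : ∀ (xs : List A) {ys} f → ∑ (xs ++ ys) f ≡ ∑ xs f + ∑ ys f
∑-++ xs {ys} f = trans (cong sum (map-++ f xs ys)) (sum-++ (map f xs) (map f ys))

∑-map : ∀ (h : A → X) xs f → ∑ (map h xs) f ≡ ∑ xs (f ∘ h)
∑-map h xs f = cong sum (sym (map-∘ xs))

∑-+ : ∀ (xs : List A) f g → ∑ xs (λ x → f x + g x) ≡ ∑ xs f + ∑ xs g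
∑-+ []       f g = refl
∑-+ (x ∷ xs) f g = trans (cong (f x + g x +_) (∑-+ xs f g))
                        (interchange +-commutativeSemigroup (f x) (g x) (∑ xs f) (∑ xs g))

∑-*ˡ : ∀ (xs : List A) c f → ∑ xs (λ x → c * f x) ≡ c * ∑ xs f
∑-*ˡ []       c f = sym (*-zeroʳ c)
∑-*ˡ (x ∷ xs) c f = trans (cong (c * f x +_) (∑-*ˡ xs c f)) (sym (*-distribˡ-+ c (f x) (∑ xs f)))

∑-*ʳ : ∀ (xs : List A) c f → ∑ xs (λ x → f x * c) ≡ ∑ xs f * c
∑-*ʳ xs c f = trans (∑-cong xs (λ {x} _ → *-comm (f x) c)) (trans (∑-*ˡ xs c f) (*-comm c (∑ xs f)))

∑-const : ∀ (xs : List A) c → ∑ xs (λ _ → c) ≡ length xs * c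
∑-const []       c = refl
∑-const (x ∷ xs) c = cong (c +_) (∑-const xs c)

∑-1 : ∀ (xs : List A) → ∑ xs (λ _ → 1) ≡ length xs
∑-1 xs = trans (∑-const xs 1) (*-identityʳ (length xs))

∑-zero : ∀ (xs : List A) {f} → (∀ {x} → x ∈ xs → f x ≡ 0) → ∑ xs f ≡ 0
∑-zero xs f≡0 = trans (∑-cong xs f≡0) (trans (∑-const xs 0) (*-zeroʳ (length xs)))

∑-swap : ∀ (xs : List A) (ys : List X) (f : A → X → ℕ) →
         ∑ xs (λ x → ∑ ys (f x)) ≡ ∑ ys (λ y → ∑ xs (λ x → f x y))
∑-swap []       ys f = sym (∑-zero ys λ _ → refl)
∑-swap (x ∷ xs) ys f = trans (cong (∑ ys (f x) +_) (∑-swap xs ys f)) (sym (∑-+ ys (f x) _))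

∑-filter : ∀ {P : Pred A ℓ} (P? : Decidable P) xs f → ∑ (filter P? xs) f ≡ ∑ xs (λ x → ⟦ P? x ⟧ * f x)
∑-filter P? []       f = refl
∑-filter P? (x ∷ xs) f with does (P? x)
... | true  = cong₂ _+_ (sym (+-identityʳ (f x))) (∑-filter P? xs f)
... | false = ∑-filter P? xs f

∑-filter-≤ : ∀ {P : Pred A ℓ} (P? : Decidable P) xs f → ∑ (filter P? xs) f ≤ ∑ xs f
∑-filter-≤ P? []       f = z≤n
∑-filter-≤ P? (x ∷ xs) f with does (P? x)
... | true  = +-monoʳ-≤ (f x) (∑-filter-≤ P? xs f)
... | false = ≤-trans (∑-filter-≤ P? xs f) (m≤n+m _ (f x))

∑-cartesianProductWith : ∀ (h : A → X → Y) xs ys f →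
  ∑ (cartesianProductWith h xs ys) f ≡ ∑ xs (λ x → ∑ ys (λ y → f (h x y)))
∑-cartesianProductWith h []       ys f = refl
∑-cartesianProductWith h (x ∷ xs) ys f =
  trans (∑-++ (map (h x) ys) f) (cong₂ _+_ (∑-map (h x) ys f) (∑-cartesianProductWith h xs ys f))

-- Induction on `xs`: its head is cut out of `ys` at one occurrence. Since `xs` has no repetitions,
-- every later entry of `xs` survives the cut.
∑-⊆ : ∀ {xs ys : List A} f → Unique xs → (∀ {x} → x ∈ xs → x ∈ ys) → ∑ xs f ≤ ∑ ys f
∑-⊆ f []           _ = z≤n
∑-⊆ {xs = x ∷ xs} f (x∉xs ∷ uxs) xs⊆ys with ∈-∃++ (xs⊆ys (here refl))
... | us , ws , refl = begin
  f x + ∑ xs f            ≤⟨ +-monoʳ-≤ (f x) (∑-⊆ f uxs xs⊆us++ws) ⟩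
  f x + ∑ (us ++ ws) f    ≡⟨ cong (f x +_) (∑-++ us f) ⟩
  f x + (∑ us f + ∑ ws f) ≡⟨ x∙yz≈y∙xz +-commutativeSemigroup (f x) (∑ us f) (∑ ws f) ⟩
  ∑ us f + (f x + ∑ ws f) ≡⟨ ∑-++ us f ⟨
  ∑ (us ++ x ∷ ws) f      ∎
  where
  open ≤-Reasoning
  xs⊆us++ws : ∀ {y} → y ∈ xs → y ∈ us ++ ws
  xs⊆us++ws y∈xs with ∈-++⁻ us (xs⊆ys (there y∈xs))
  ... | inj₁ y∈us         = ∈-++⁺ˡ y∈us
  ... | inj₂ (here refl)  = contradiction refl (All.lookup x∉xs y∈xs)
  ... | inj₂ (there y∈ws) = ∈-++⁺ʳ us y∈ws

∑< : ℕ → (ℕ → ℕ) → ℕ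
∑< n f = ∑ (upTo n) f

∑<-suc : ∀ n f → ∑< (suc n) f ≡ ∑< n f + f n
∑<-suc n f = begin
  ∑ (upTo (suc n)) f     ≡⟨ cong (λ xs → ∑ xs f) (upTo-∷ʳ n) ⟨
  ∑ (upTo n List.∷ʳ n) f ≡⟨ ∑-++ (upTo n) f ⟩
  ∑< n f + (f n + 0)     ≡⟨ cong (∑< n f +_) (+-identityʳ (f n)) ⟩
  ∑< n f + f n           ∎
  where open ≡-Reasoning

∑<-+ : ∀ m n f → ∑< (m + n) f ≡ ∑< m f + ∑< n (λ j → f (m + j))
∑<-+ m zero f = trans (cong (λ k → ∑< k f) (+-identityʳ m)) (sym (+-identityʳ (∑< m f)))
∑<-+ m (suc n) f = begin
  ∑< (m + suc n) f                                ≡⟨ cong (λ k → ∑< k f) (+-suc m n) ⟩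
  ∑< (suc (m + n)) f                              ≡⟨ ∑<-suc (m + n) f ⟩
  ∑< (m + n) f + f (m + n)                        ≡⟨ cong (_+ f (m + n)) (∑<-+ m n f) ⟩
  ∑< m f + ∑< n (λ j → f (m + j)) + f (m + n)     ≡⟨ +-assoc (∑< m f) _ _ ⟩
  ∑< m f + (∑< n (λ j → f (m + j)) + f (m + n))   ≡⟨ cong (∑< m f +_) (∑<-suc n (λ j → f (m + j))) ⟨
  ∑< m f + ∑< (suc n) (λ j → f (m + j))           ∎
  where open ≡-Reasoning

∑<-head : ∀ n f → ∑< (suc n) f ≡ f 0 + ∑< n (f ∘ suc)
∑<-head n f = trans (∑<-+ 1 n f) (cong (_+ ∑< n (f ∘ suc)) (+-identityʳ (f 0)))

-- Binomial coefficients and the middle layers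

nCk*k![n∸k]!≡n! : ∀ {n k} → k ≤ n → (n C k) * (k ! * (n ∸ k) !) ≡ n !
nCk*k![n∸k]!≡n! {n} {k} k≤n =
  trans (cong (_* (k ! * (n ∸ k) !)) (nCk≡n!/k![n-k]! k≤n)) (m/n*n≡m {{k !* (n ∸ k) !≢0}} (k![n∸k]!∣n! k≤n))

0<nCk : ∀ {n k} → k ≤ n → 1 ≤ n C k
0<nCk {n} {k} k≤n = n≢0⇒n>0 λ nCk≡0 →
  ≢-nonZero⁻¹ (n !) {{n !≢0}} (trans (sym (nCk*k![n∸k]!≡n! k≤n)) (cong (_* (k ! * (n ∸ k) !)) nCk≡0))

[i+j]Ci≡[i+j]Cj : ∀ i j → (i + j) C i ≡ (i + j) C j
[i+j]Ci≡[i+j]Cj i j = trans (nCk≡nC[n∸k] (m≤m+n i j)) (cong ((i + j) C_) (m+n∸m≡n i j))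

-- Pascal's rule and induction compare the two summands pairwise. If `i + suc j` equals the smaller
-- `n`, the hypothesis fails for the second pair, but then symmetry matches each summand on the left
-- with the opposite one on the right.
nCi≤nCj : ∀ {n i j} → i ≤ j → i + j ≤ n → n C i ≤ n C j
nCi≤nCj {n} {zero} {j} _ j≤n = 0<nCk j≤n
nCi≤nCj {suc n} {suc i} {suc j} (s≤s i≤j) (s≤s i+1+j≤n) = begin
  suc n C suc i       ≡⟨ nCk+nC[k+1]≡[n+1]C[k+1] n i ⟨
  n C i + n C suc i   ≤⟨ pascal ⟩
  n C j + n C suc j   ≡⟨ nCk+nC[k+1]≡[n+1]C[k+1] n j ⟩
  suc n C suc j       ∎
  where
  open ≤-Reasoning
  i+j<n : suc (i + j) ≤ n
  i+j<n = subst (_≤ n) (+-suc i j) i+1+j≤n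
  pascal : n C i + n C suc i ≤ n C j + n C suc j
  pascal with m≤n⇒m<n∨m≡n i+j<n
  ... | inj₁ i+j+2≤n = +-mono-≤ (nCi≤nCj i≤j (<⇒≤ i+j<n))
                         (nCi≤nCj (s≤s i≤j) (subst (_≤ n) (cong suc (sym (+-suc i j))) i+j+2≤n))
  ... | inj₂ refl    = ≤-reflexive (trans (+-comm (suc (i + j) C i) _)
                         (cong₂ _+_ ([i+j]Ci≡[i+j]Cj (suc i) j)
                           (subst (λ n → n C i ≡ n C suc j) (+-suc i j) ([i+j]Ci≡[i+j]Cj i (suc j)))))

-- Reflecting `j` to `n ∸ j` reduces this to `nCi≤nCj`; above `n` the coefficient is 0.
nCj≤nCi : ∀ {n i j} → i ≤ j → n ≤ i + j → n C j ≤ n C i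
nCj≤nCi {n} {i} {j} i≤j n≤i+j with j ≤? n
... | no  j≰n = ≤-trans (≤-reflexive (k>n⇒nCk≡0 (≰⇒> j≰n))) z≤n
... | yes j≤n = begin
  n C j        ≡⟨ nCk≡nC[n∸k] j≤n ⟩
  n C (n ∸ j)  ≤⟨ nCi≤nCj (m≤n+o⇒m∸n≤o n j (subst (n ≤_) (+-comm i j) n≤i+j))
                    (≤-trans (+-monoʳ-≤ (n ∸ j) i≤j) (≤-reflexive (m∸n+n≡m j≤n))) ⟩
  n C i        ∎
  where open ≤-Reasoning

-- Along Pascal's rule each step from `a` to `suc a` adds a positive coefficient. The bound serves
-- in `next-middle`, where a new middle coefficient must be large enough.
a<[a+b]Ca : ∀ a b → 1 ≤ b → suc a ≤ (a + b) C a
a<[a+b]Ca zero    b       _ = ≤-refl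
a<[a+b]Ca (suc a) (suc b) 1≤b = begin
  suc (suc a)                                    ≡⟨ +-comm 1 (suc a) ⟩
  suc a + 1                                      ≤⟨ +-mono-≤ (a<[a+b]Ca a (suc b) 1≤b) (0<nCk suc[a]≤) ⟩
  (a + suc b) C a + (a + suc b) C suc a          ≡⟨ nCk+nC[k+1]≡[n+1]C[k+1] (a + suc b) a ⟩
  (suc a + suc b) C suc a                        ∎
  where
  open ≤-Reasoning
  suc[a]≤ : suc a ≤ a + suc b
  suc[a]≤ = ≤-trans (s≤s (m≤m+n a b)) (≤-reflexive (sym (+-suc a b)))

-- The two halves of `allSubsets (suc n)`, without and with the new point, correspond to the two
-- summands of Pascal's rule.
∑-allSubsets : ∀ n (g : ℕ → ℕ) → ∑ (allSubsets n) (λ A → g ∣ A ∣) ≡ ∑< (suc n) (λ i → (n C i) * g i)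
∑-allSubsets zero    g = cong (_+ 0) (sym (+-identityʳ (g 0)))
∑-allSubsets (suc n) g = begin
  ∑ (allSubsets (suc n)) (λ A → g ∣ A ∣)
    ≡⟨ ∑-++ (map (outside Vec.∷_) (allSubsets n)) _ ⟩
  ∑ (map (outside Vec.∷_) (allSubsets n)) (λ A → g ∣ A ∣) + ∑ (map (inside Vec.∷_) (allSubsets n)) (λ A → g ∣ A ∣)
    ≡⟨ cong₂ _+_ (∑-map _ (allSubsets n) _) (∑-map _ (allSubsets n) _) ⟩
  ∑ (allSubsets n) (λ A → g ∣ A ∣) + ∑ (allSubsets n) (λ A → g (suc ∣ A ∣))
    ≡⟨ cong₂ _+_ (∑-allSubsets n g) (∑-allSubsets n (g ∘ suc)) ⟩
  ∑< (suc n) (λ i → (n C i) * g i) + S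
    ≡⟨ cong (_+ S) top ⟨
  ∑< (suc (suc n)) (λ i → (n C i) * g i) + S
    ≡⟨ cong (_+ S) (∑<-head (suc n) (λ i → (n C i) * g i)) ⟩
  (n C 0) * g 0 + S′ + S
    ≡⟨ trans (+-assoc ((n C 0) * g 0) S′ S) (cong ((n C 0) * g 0 +_) (+-comm S′ S)) ⟩
  (suc n C 0) * g 0 + (S + S′)
    ≡⟨ cong ((suc n C 0) * g 0 +_) (∑-+ (upTo (suc n)) (λ i → (n C i) * g (suc i)) (λ i → (n C suc i) * g (suc i))) ⟨
  (suc n C 0) * g 0 + ∑< (suc n) (λ i → (n C i) * g (suc i) + (n C suc i) * g (suc i))
    ≡⟨ cong ((suc n C 0) * g 0 +_) (∑-cong (upTo (suc n)) λ {i} _ →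
         trans (sym (*-distribʳ-+ (g (suc i)) (n C i) (n C suc i))) (cong (_* g (suc i)) (nCk+nC[k+1]≡[n+1]C[k+1] n i))) ⟩
  (suc n C 0) * g 0 + ∑< (suc n) (λ i → (suc n C suc i) * g (suc i))
    ≡⟨ ∑<-head (suc n) (λ i → (suc n C i) * g i) ⟨
  ∑< (suc (suc n)) (λ i → (suc n C i) * g i) ∎
  where
  open ≡-Reasoning
  S  = ∑< (suc n) (λ i → (n C i) * g (suc i))
  S′ = ∑< (suc n) (λ i → (n C suc i) * g (suc i))
  top : ∑< (suc (suc n)) (λ i → (n C i) * g i) ≡ ∑< (suc n) (λ i → (n C i) * g i)
  top = trans (∑<-suc (suc n) (λ i → (n C i) * g i))
       (trans (cong (λ z → ∑< (suc n) (λ i → (n C i) * g i) + z * g (suc n)) (k>n⇒nCk≡0 (n<1+n n))) (+-identityʳ _))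

[q*2+e]/2≡q : ∀ q {e} → e ≤ 1 → (q * 2 + e) / 2 ≡ q
[q*2+e]/2≡q q {e} e≤1 = trans (+-distrib-/-∣ˡ {q * 2} e {2} (divides-refl q))
                        (trans (cong₂ _+_ (m*n/n≡m q 2) (e/2 e≤1)) (+-identityʳ q))
  where
  e/2 : ∀ {e} → e ≤ 1 → e / 2 ≡ 0
  e/2 z≤n       = refl
  e/2 (s≤s z≤n) = refl

half : ∀ n → ∃₂ λ q e → e ≤ 1 × n ≡ q * 2 + e
half zero          = 0 , 0 , z≤n , refl
half (suc zero)    = 0 , 1 , ≤-refl , refl
half (suc (suc n)) with half n
... | q , e , e≤1 , refl = suc q , e , e≤1 , refl

-- With `q` as the lowest middle level the highest is `q + m - 1`, here `h`. Positivity of `n` makes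
-- `q + m` nonzero; for `n = m = 0` the highest level would be -1.
highestMiddle≡ : ∀ n m q {e} → e ≤ 1 → suc n ≡ m + (q * 2 + e) → 1 ≤ n →
                 ∃ λ h → q + m ≡ suc h × highestMiddle n m ≡ ℤ.+ h
highestMiddle≡ (suc n) m q {e} e≤1 2+n≡ _ with q + m in eq
... | zero with refl ← m+n≡0⇒m≡0 q eq | refl ← m+n≡0⇒n≡0 q eq =
  contradiction (subst (_≤ 1) (sym 2+n≡) e≤1) λ { (s≤s ()) }
... | suc h = h , refl , cong ℤ.+_ (trans (cong (_/ 2) n+m≡) ([q*2+e]/2≡q h e≤1))
  where
  lemma : ∀ m q e → m + (q * 2 + e) + m ≡ (q + m) * 2 + e
  lemma = solve-∀
  n+m≡ : n + m ≡ h * 2 + e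
  n+m≡ = +-cancelˡ-≡ 2 _ _ (trans (cong (_+ m) 2+n≡) (trans (lemma m q e) (cong (λ z → z * 2 + e) eq)))

-- The equation cuts the `suc n` levels into `q` below the middle, `m` middle ones starting at level
-- `q`, and `q + e` above, where `e` is the parity of `suc n ∸ m`.
module _ (n m q e : ℕ) (e≤1 : e ≤ 1) (1+n≡ : suc n ≡ m + (q * 2 + e)) where

  private
    1+n≡q+m+q+e : suc n ≡ q + (m + (q + e))
    1+n≡q+m+q+e = trans 1+n≡ (lemma m q e)
      where
      lemma : ∀ m q e → m + (q * 2 + e) ≡ q + (m + (q + e))
      lemma = solve-∀

    ∑-split : ∀ f → ∑< (suc n) f ≡ ∑< q f + (∑< m (λ j → f (q + j)) + ∑< (q + e) (λ j → f (q + (m + j))))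
    ∑-split f = trans (cong (λ k → ∑< k f) 1+n≡q+m+q+e)
             (trans (∑<-+ q (m + (q + e)) f) (cong (∑< q f +_) (∑<-+ m (q + e) (λ j → f (q + j)))))

  lowestMiddle≡ : lowestMiddle n m ≡ ℤ.+ q
  lowestMiddle≡ = trans (cong (ℤ._/ℕ 2) eq) (cong ℤ.+_ ([q*2+e]/2≡q q e≤1))
    where
    lemma : ∀ x y → (ℤ.- ℤ.1ℤ ℤ.+ (x ℤ.+ y)) ℤ.- x ℤ.+ ℤ.1ℤ ≡ y
    lemma = ℤSolver.solve-∀
    eq : ℤ.+ n ℤ.- ℤ.+ m ℤ.+ ℤ.1ℤ ≡ ℤ.+ (q * 2 + e)
    -- `+ n` is the normal form of -1 plus `+ suc n`, which lets `1+n≡` be substituted for `suc n`.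
    eq = trans (cong (λ z → (ℤ.- ℤ.1ℤ ℤ.+ ℤ.+ z) ℤ.- ℤ.+ m ℤ.+ ℤ.1ℤ) 1+n≡) (lemma (ℤ.+ m) (ℤ.+ (q * 2 + e)))

  Σ𝓑≡ : 1 ≤ n → Σ𝓑 n m ≡ ∑< m (λ j → n C (q + j))
  Σ𝓑≡ 1≤n with highestMiddle≡ n m q e≤1 1+n≡ 1≤n
  ... | h , q+m≡1+h , hi≡ = begin
    Σ𝓑 n m                                              ≡⟨ ∑-1 (𝓑 n m) ⟨
    ∑ (𝓑 n m) (λ _ → 1)                                 ≡⟨ ∑-filter (λ A → D? ∣ A ∣) (allSubsets n) _ ⟩
    ∑ (allSubsets n) (λ A → g ∣ A ∣)                     ≡⟨ ∑-allSubsets n g ⟩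
    ∑< (suc n) f                                        ≡⟨ ∑-split f ⟩
    ∑< q f + (∑< m (λ j → f (q + j)) + ∑< (q + e) (λ j → f (q + (m + j))))
      ≡⟨ cong₂ _+_ below (cong₂ _+_ middle above) ⟩
    0 + (∑< m (λ j → n C (q + j)) + 0)                  ≡⟨ +-identityʳ _ ⟩
    ∑< m (λ j → n C (q + j))                            ∎
    where
    open ≡-Reasoning
    D? = λ i → (lowestMiddle n m ℤ.≤? ℤ.+ i) ×-dec (ℤ.+ i ℤ.≤? highestMiddle n m)
    g = λ i → ⟦ D? i ⟧ * 1
    f = λ i → (n C i) * g i
    lo≤ : ∀ {i} → lowestMiddle n m ℤ.≤ ℤ.+ i → q ≤ i
    lo≤ {i} p = ℤ.drop‿+≤+ (subst (ℤ._≤ ℤ.+ i) lowestMiddle≡ p)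
    ≤hi : ∀ {i} → ℤ.+ i ℤ.≤ highestMiddle n m → i < q + m
    ≤hi {i} p = ≤-trans (s≤s (ℤ.drop‿+≤+ (subst (ℤ.+ i ℤ.≤_) hi≡ p))) (≤-reflexive (sym q+m≡1+h))
    below : ∑< q f ≡ 0
    below = ∑-zero (upTo q) λ {i} i∈ → trans (cong (λ z → (n C i) * (z * 1))
      (⟦⟧-false (D? i) λ (lo , _) → <⇒≱ (∈-upTo⁻ i∈) (lo≤ lo))) (*-zeroʳ (n C i))
    above : ∑< (q + e) (λ j → f (q + (m + j))) ≡ 0
    above = ∑-zero (upTo (q + e)) λ {j} _ → trans (cong (λ z → (n C (q + (m + j))) * (z * 1))
      (⟦⟧-false (D? (q + (m + j))) λ (_ , hi) → <⇒≱ (≤hi hi)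
        (≤-trans (m≤m+n (q + m) j) (≤-reflexive (+-assoc q m j))))) (*-zeroʳ (n C (q + (m + j))))
    middle : ∑< m (λ j → f (q + j)) ≡ ∑< m (λ j → n C (q + j))
    middle = ∑-cong (upTo m) λ {j} j∈ → trans (cong (λ z → (n C (q + j)) * (z * 1))
      (⟦⟧-true (D? (q + j))
        ( subst (ℤ._≤ ℤ.+ (q + j)) (sym lowestMiddle≡) (ℤ.+≤+ (m≤m+n q j))
        , subst (ℤ.+ (q + j) ℤ.≤_) (sym hi≡) (ℤ.+≤+ (s≤s⁻¹ (≤-trans (+-monoʳ-< q (∈-upTo⁻ j∈)) (≤-reflexive q+m≡1+h)))))))
      (*-identityʳ _)

  -- n C q is the smallest of the m middle binomial coefficients, and no other coefficient exceeds it.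
  threshold : (n C q) * m + ∑< (suc n) (λ i → n C i ∸ n C q) ≤ ∑< m (λ j → n C (q + j))
  threshold = begin
    t * m + ∑< (suc n) f
      ≡⟨ cong₂ _+_ (*-comm t m) (∑-split f) ⟩
    m * t + (∑< q f + (∑< m (λ j → f (q + j)) + ∑< (q + e) (λ j → f (q + (m + j)))))
      ≡⟨ cong (m * t +_) (cong₂ _+_ below (cong (∑< m (λ j → f (q + j)) +_) above)) ⟩
    m * t + (0 + (∑< m (λ j → f (q + j)) + 0))
      ≡⟨ cong₂ _+_ (trans (∑-const (upTo m) t) (cong (_* t) (length-upTo m))) (sym (+-identityʳ _)) ⟨
    ∑< m (λ _ → t) + ∑< m (λ j → f (q + j))
      ≡⟨ ∑-+ (upTo m) _ _ ⟨
    ∑< m (λ j → t + (n C (q + j) ∸ t))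
      ≡⟨ ∑-cong (upTo m) (λ {j} j∈ → m+[n∸m]≡n (nCi≤nCj (m≤m+n q j) (middle (∈-upTo⁻ j∈)))) ⟩
    ∑< m (λ j → n C (q + j)) ∎
    where
    open ≤-Reasoning
    t = n C q
    f = λ i → n C i ∸ t
    middle : ∀ {j} → j < m → q + (q + j) ≤ n
    middle {j} j<m = s≤s⁻¹ (begin
      suc (q + (q + j))        ≡⟨ lemma q j ⟩
      suc j + q * 2            ≤⟨ +-mono-≤ j<m (m≤m+n (q * 2) e) ⟩
      m + (q * 2 + e)          ≡⟨ 1+n≡ ⟨
      suc n                    ∎)
      where
      lemma : ∀ q j → suc (q + (q + j)) ≡ suc j + q * 2
      lemma = solve-∀
    below : ∑< q f ≡ 0
    below = ∑-zero (upTo q) λ {i} i∈ → m≤n⇒m∸n≡0 (nCi≤nCj (<⇒≤ (∈-upTo⁻ i∈)) (s≤s⁻¹ (begin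
      suc i + q                ≤⟨ +-monoˡ-≤ q (∈-upTo⁻ i∈) ⟩
      q + q                    ≤⟨ +-monoʳ-≤ q (≤-trans (m≤m+n q e) (m≤n+m (q + e) m)) ⟩
      q + (m + (q + e))        ≡⟨ 1+n≡q+m+q+e ⟨
      suc n                    ∎)))
    above : ∑< (q + e) (λ j → f (q + (m + j))) ≡ 0
    above = ∑-zero (upTo (q + e)) λ {j} j∈ → m≤n⇒m∸n≡0 (nCj≤nCi (m≤m+n q (m + j)) (s≤s⁻¹ (begin
      suc n                    ≡⟨ 1+n≡q+m+q+e ⟩
      q + (m + (q + e))        ≤⟨ +-monoʳ-≤ q (+-monoʳ-≤ m (+-monoʳ-≤ q e≤1)) ⟩
      q + (m + (q + 1))        ≤⟨ m≤m+n _ j ⟩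
      q + (m + (q + 1)) + j    ≡⟨ lemma q m j ⟩
      suc (q + (q + (m + j)))  ∎)))
      where
      lemma : ∀ q m j → q + (m + (q + 1)) + j ≡ suc (q + (q + (m + j)))
      lemma = solve-∀

-- Falling factorials and products of gap factorials

falling : ℕ → ℕ → ℕ
falling N zero    = 1
falling N (suc j) = falling N j * (N ∸ j)

falling-mono : ∀ {M N} j → M ≤ N → falling M j ≤ falling N j
falling-mono zero    M≤N = ≤-refl
falling-mono (suc j) M≤N = *-mono-≤ (falling-mono j M≤N) (∸-monoˡ-≤ j M≤N)

falling-! : ∀ {N} j → j ≤ N → falling N j * (N ∸ j) ! ≡ N !
falling-! {N} zero    _   = +-identityʳ (N !)
falling-! {N} (suc j) j<N = begin
  falling N j * (N ∸ j) * (N ∸ suc j) !     ≡⟨ *-assoc (falling N j) (N ∸ j) _ ⟩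
  falling N j * ((N ∸ j) * (N ∸ suc j) !)   ≡⟨ cong (falling N j *_) ([n-k]*[n-k-1]!≡[n-k]! j<N) ⟩
  falling N j * (N ∸ j) !                   ≡⟨ falling-! j (<⇒≤ j<N) ⟩
  N !                                  ∎
  where open ≡-Reasoning

falling≡0 : ∀ {N j} → N < j → falling N j ≡ 0
falling≡0 {N} {suc j} (s≤s N≤j) = trans (cong (falling N j *_) (m≤n⇒m∸n≡0 N≤j)) (*-zeroʳ (falling N j))

falling-suc : ∀ h j → falling (suc h) (suc j) ≡ suc h * falling h j
falling-suc h zero    = *-comm 1 (suc h)
falling-suc h (suc j) = trans (cong (_* (h ∸ j)) (falling-suc h j)) (*-assoc (suc h) (falling h j) (h ∸ j))

-- Two positive gaps are replaced by gaps of lengths 1 and `suc (g + h)` with the same total; the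
-- product of the factorials does not decrease.
[1+g]![1+h]!≤[1+g+h]! : ∀ g h → suc g ! * suc h ! ≤ suc (g + h) !
[1+g]![1+h]!≤[1+g+h]! zero    h = ≤-reflexive (+-identityʳ (suc h !))
[1+g]![1+h]!≤[1+g+h]! (suc g) h = begin
  suc (suc g) * suc g ! * suc h !      ≡⟨ *-assoc (suc (suc g)) (suc g !) (suc h !) ⟩
  suc (suc g) * (suc g ! * suc h !)    ≤⟨ *-mono-≤ (s≤s (s≤s (m≤m+n g h))) ([1+g]![1+h]!≤[1+g+h]! g h) ⟩
  suc (suc (g + h)) * suc (g + h) !    ∎
  where open ≤-Reasoning

lastOr : ℕ → List ℕ → ℕ
lastOr p []       = p
lastOr p (a ∷ as) = lastOr a as

-- The number of maximal chains of the interval from level p to level n of the Boolean lattice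
-- through prescribed nested sets of sizes as.
gaps! : ℕ → ℕ → List ℕ → ℕ
gaps! n p []       = (n ∸ p) !
gaps! n p (a ∷ as) = (a ∸ p) ! * gaps! n a as

<⇒∃ : ∀ {p a} → p < a → ∃ λ g → a ≡ p + suc g
<⇒∃ {p} {a} p<a = a ∸ suc p , sym (trans (+-suc p (a ∸ suc p)) (m+[n∸m]≡n p<a))

gap≡ : ∀ p g → p + suc g ∸ p ≡ suc g
gap≡ p g = m+n∸m≡n p (suc g)

private
  regroup : ∀ p g l r → p + suc g + l + suc r ≡ p + suc l + suc (g + r)
  regroup = solve-∀

p+length≤lastOr : ∀ {p as} → Linked _<_ (p ∷ as) → p + length as ≤ lastOr p as
p+length≤lastOr {p} [-]         = ≤-reflexive (+-identityʳ p)
p+length≤lastOr {p} {a ∷ as} (p<a ∷ l) =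
  ≤-trans (≤-reflexive (+-suc p (length as))) (≤-trans (+-monoˡ-≤ (length as) p<a) (p+length≤lastOr l))

-- All gaps from `p` up to `n` are positive, the last one by `lastOr p as < n`. Merging them one
-- after another leaves `length as` gaps of length 1 and a single gap of length `suc r`.
gaps!-below : ∀ {n p as} → Linked _<_ (p ∷ as) → lastOr p as < n →
              ∃ λ r → n ≡ p + length as + suc r × gaps! n p as ≤ suc r !
gaps!-below {n} {p} [-] p<n with <⇒∃ p<n
... | g , refl = g , cong (_+ suc g) (sym (+-identityʳ p)) , ≤-reflexive (cong _! (gap≡ p g))
gaps!-below {n} {p} {a ∷ as} (p<a ∷ l) last<n with <⇒∃ p<a | gaps!-below l last<n
... | g , refl | r , n≡ , ih = g + r , trans n≡ (regroup p g (length as) r) , (begin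
  (p + suc g ∸ p) ! * gaps! n a as   ≡⟨ cong (λ z → z ! * gaps! n a as) (gap≡ p g) ⟩
  suc g ! * gaps! n a as             ≤⟨ *-monoʳ-≤ (suc g !) ih ⟩
  suc g ! * suc r !                  ≤⟨ [1+g]![1+h]!≤[1+g+h]! g r ⟩
  suc (g + r) !                      ∎)
  where open ≤-Reasoning

-- The same merging, except that the gap between the last size and `n` stays apart: its factorial is
-- the one to be cancelled by the weight, and it may be 0! = 1.
gaps!-above : ∀ {n p a as} → Linked _<_ (p ∷ a ∷ as) →
              ∃ λ r → lastOr a as ≡ p + length as + suc r × gaps! n p (a ∷ as) ≤ suc r ! * (n ∸ lastOr a as) !
gaps!-above {n} {p} {a} (p<a ∷ [-]) with <⇒∃ p<a
... | g , refl = g , cong (_+ suc g) (sym (+-identityʳ p)) ,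
                 ≤-reflexive (cong (λ z → z ! * (n ∸ (p + suc g)) !) (gap≡ p g))
gaps!-above {n} {p} {a} {b ∷ as} (p<a ∷ l) with <⇒∃ p<a | gaps!-above {n} l
... | g , refl | r , last≡ , ih = g + r , trans last≡ (regroup p g (length as) r) , (begin
  (p + suc g ∸ p) ! * gaps! n a (b ∷ as)     ≡⟨ cong (λ z → z ! * gaps! n a (b ∷ as)) (gap≡ p g) ⟩
  suc g ! * gaps! n a (b ∷ as)               ≤⟨ *-monoʳ-≤ (suc g !) ih ⟩
  suc g ! * (suc r ! * rest)                 ≡⟨ *-assoc (suc g !) (suc r !) rest ⟨
  suc g ! * suc r ! * rest                   ≤⟨ *-monoˡ-≤ rest ([1+g]![1+h]!≤[1+g+h]! g r) ⟩
  suc (g + r) ! * rest                       ∎)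
  where
  open ≤-Reasoning
  rest = (n ∸ lastOr b as) !

m≤n*2+1⇒m/2≤n : ∀ {m n} → m ≤ n * 2 + 1 → m / 2 ≤ n
m≤n*2+1⇒m/2≤n {m} {n} m≤ = ≤-trans (/-mono-≤ m≤ (≤-refl {2})) (≤-reflexive ([q*2+e]/2≡q n ≤-refl))

-- w cancels one of the two outer factorials of gaps!; the remaining gaps are positive and sum to at least
-- (n + suc (length as)) / 2, so the product of their factorials is largest when all but one are 1.
gaps!*w*falling≤n! : ∀ n a as w → Linked _<_ (a ∷ as) → lastOr a as ≤ n → ¬ (a ≡ 0 × lastOr a as ≡ n) →
                w ≤ n C a → w ≤ n C lastOr a as →
                gaps! n 0 (a ∷ as) * w * falling ((n + suc (length as)) / 2) (length as) ≤ n !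
gaps!*w*falling≤n! n a as w l last≤n good w≤first w≤last with a + lastOr a as ≤? n
... | yes a+last≤n with gaps!-below l (≤∧≢⇒< last≤n λ last≡n → good (a≡0 last≡n , last≡n))
  where
  -- A last size `n` would force `a` to be 0 in this case, and that combination is excluded by
  -- `good`.
  a≡0 : lastOr a as ≡ n → a ≡ 0
  a≡0 last≡n = n≤0⇒n≡0 (+-cancelʳ-≤ (lastOr a as) a 0 (subst (a + lastOr a as ≤_) (sym last≡n) a+last≤n))
...   | r , refl , ih = begin
  a ! * gaps! n′ a as * w * falling N m          ≤⟨ *-mono-≤ (*-mono-≤ (*-monoʳ-≤ (a !) ih) w≤first) (falling-mono m N≤M) ⟩
  a ! * suc r ! * (n′ C a) * falling M m         ≡⟨ lemma (a !) (suc r !) (n′ C a) (falling M m) ⟩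
  (n′ C a) * (a ! * (falling M m * suc r !))     ≡⟨ cong (λ z → (n′ C a) * (a ! * (falling M m * z !))) (m+n∸m≡n m (suc r)) ⟨
  (n′ C a) * (a ! * (falling M m * (M ∸ m) !))   ≡⟨ cong (λ z → (n′ C a) * (a ! * z)) (falling-! m (m≤m+n m (suc r))) ⟩
  (n′ C a) * (a ! * M !)                    ≡⟨ cong (λ z → (n′ C a) * (a ! * z !)) n∸a≡M ⟨
  (n′ C a) * (a ! * (n′ ∸ a) !)             ≡⟨ nCk*k![n∸k]!≡n! a≤n ⟩
  n′ !                                      ∎
  where
  open ≤-Reasoning
  m  = length as
  M  = m + suc r
  n′ = a + m + suc r
  N  = (n′ + suc m) / 2
  lemma : ∀ x y u v → x * y * u * v ≡ u * (x * (v * y))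
  lemma = solve-∀
  n∸a≡M : n′ ∸ a ≡ M
  n∸a≡M = trans (cong (_∸ a) (+-assoc a m (suc r))) (m+n∸m≡n a M)
  a≤n : a ≤ n′
  a≤n = ≤-trans (m≤m+n a M) (≤-reflexive (sym (+-assoc a m (suc r))))
  a+m≤M : a + m ≤ M
  a+m≤M = +-cancelˡ-≤ a _ _ (≤-trans (+-monoʳ-≤ a (p+length≤lastOr l))
                            (≤-trans a+last≤n (≤-reflexive (+-assoc a m (suc r)))))
  -- `M` is `n ∸ a`, the total of the gaps above `a`. The last size lies between `a + m` and
  -- `n ∸ a`, so `a + m ≤ M`, which bounds the half of `n + suc m`.
  N≤M : N ≤ M
  N≤M = m≤n*2+1⇒m/2≤n (begin
    a + m + suc r + suc m    ≡⟨ lemma₁ a m r ⟩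
    a + m + (M + 1)          ≤⟨ +-monoˡ-≤ (M + 1) a+m≤M ⟩
    M + (M + 1)              ≡⟨ lemma₂ M ⟩
    M * 2 + 1                ∎)
    where
    lemma₁ : ∀ a m r → a + m + suc r + suc m ≡ a + m + (m + suc r + 1)
    lemma₁ = solve-∀
    lemma₂ : ∀ M → M + (M + 1) ≡ M * 2 + 1
    lemma₂ = solve-∀
gaps!*w*falling≤n! n a as w l last≤n good w≤first w≤last | no a+last≰n with gaps!-above {n} (0<a ∷ l)
  where
  -- With `a` equal to 0 the previous case would apply, so the gap from 0 to `a` is positive and can
  -- be merged with the others.
  0<a : 0 < a
  0<a = n≢0⇒n>0 λ { refl → a+last≰n last≤n }
... | r , last≡ , ih = begin
  gaps! n 0 (a ∷ as) * w * falling N m                ≤⟨ *-mono-≤ (*-mono-≤ ih w≤last) (falling-mono m N≤L) ⟩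
  suc r ! * (n ∸ L) ! * (n C L) * falling L m         ≡⟨ lemma (suc r !) ((n ∸ L) !) (n C L) (falling L m) ⟩
  (n C L) * (falling L m * suc r ! * (n ∸ L) !)       ≡⟨ cong (λ z → (n C L) * (falling L m * z ! * (n ∸ L) !)) L∸m≡ ⟨
  (n C L) * (falling L m * (L ∸ m) ! * (n ∸ L) !)     ≡⟨ cong (λ z → (n C L) * (z * (n ∸ L) !)) (falling-! m m≤L) ⟩
  (n C L) * (L ! * (n ∸ L) !)                    ≡⟨ nCk*k![n∸k]!≡n! last≤n ⟩
  n !                                            ∎
  where
  open ≤-Reasoning
  m = length as
  L = lastOr a as
  N = (n + suc m) / 2
  lemma : ∀ x y u v → x * y * u * v ≡ u * (v * x * y)
  lemma = solve-∀
  m≤L : m ≤ L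
  m≤L = ≤-trans (m≤n+m m a) (p+length≤lastOr l)
  L∸m≡ : L ∸ m ≡ suc r
  L∸m≡ = trans (cong (_∸ m) last≡) (m+n∸m≡n m (suc r))
  N≤L : N ≤ L
  N≤L = m≤n*2+1⇒m/2≤n (begin
    n + suc m           ≤⟨ +-monoˡ-≤ (suc m) (<⇒≤ (≰⇒> a+last≰n)) ⟩
    a + L + suc m       ≡⟨ lemma₁ a m L ⟩
    a + m + (L + 1)     ≤⟨ +-monoˡ-≤ (L + 1) (p+length≤lastOr l) ⟩
    L + (L + 1)         ≡⟨ lemma₂ L ⟩
    L * 2 + 1           ∎)
    where
    lemma₁ : ∀ a m L → a + L + suc m ≡ a + m + (L + 1)
    lemma₁ = solve-∀
    lemma₂ : ∀ M → M + (M + 1) ≡ M * 2 + 1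
    lemma₂ = solve-∀

-- Maximal chains

-- The new point is absent up to level i and present from level i + 1 on.
insertAt : ℕ → (ℕ → Subset n) → ℕ → Subset (suc n)
insertAt i c j = if does (j ≤? i) then outside Vec.∷ c j else inside Vec.∷ c (pred j)

-- A maximal chain is represented by the function sending i to its member of size i (arguments above n are junk).
maxChains : ∀ n → List (ℕ → Subset n)
maxChains zero    = (λ _ → Vec.[]) ∷ []
maxChains (suc n) = cartesianProductWith insertAt (upTo (suc n)) (maxChains n)

insertAt-≤ : ∀ {i j} {c : ℕ → Subset n} → j ≤ i → insertAt i c j ≡ outside Vec.∷ c j
insertAt-≤ {i = i} {j} {c} j≤i = cong (if_then outside Vec.∷ c j else inside Vec.∷ c (pred j)) (dec-true (j ≤? i) j≤i)

insertAt-> : ∀ {i j} {c : ℕ → Subset n} → i < j → insertAt i c j ≡ inside Vec.∷ c (pred j)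
insertAt-> {i = i} {j} {c} i<j = cong (if_then outside Vec.∷ c j else inside Vec.∷ c (pred j)) (dec-false (j ≤? i) (<⇒≱ i<j))

∣maxChain∣ : ∀ n {c} → c ∈ maxChains n → ∀ {i} → i ≤ n → ∣ c i ∣ ≡ i
∣maxChain∣ zero    (here refl) z≤n = refl
∣maxChain∣ (suc n) c∈ {i} i≤n with ∈-cartesianProductWith⁻ insertAt (upTo (suc n)) (maxChains n) c∈
... | j , c , j∈ , c∈′ , refl with i ≤? j
...   | yes i≤j rewrite insertAt-≤ {c = c} i≤j = ∣maxChain∣ n c∈′ (≤-trans i≤j (s≤s⁻¹ (∈-upTo⁻ j∈)))
...   | no  i≰j rewrite insertAt-> {c = c} (≰⇒> i≰j) with s≤s j≤i ← ≰⇒> i≰j = cong suc (∣maxChain∣ n c∈′ (s≤s⁻¹ i≤n))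

maxChain-⊂ : ∀ n {c} → c ∈ maxChains n → ∀ {i j} → i < j → j ≤ n → c i ⊂ c j
maxChain-⊂ zero    c∈ i<j j≤0 = contradiction (≤-trans i<j j≤0) λ ()
maxChain-⊂ (suc n) c∈ {i} {j} i<j j≤n with ∈-cartesianProductWith⁻ insertAt (upTo (suc n)) (maxChains n) c∈
... | k , c , k∈ , c∈′ , refl with i ≤? k | j ≤? k
...   | yes i≤k | yes j≤k rewrite insertAt-≤ {c = c} i≤k | insertAt-≤ {c = c} j≤k =
        s⊂s (maxChain-⊂ n c∈′ i<j (≤-trans j≤k (s≤s⁻¹ (∈-upTo⁻ k∈))))
...   | no i≰k  | yes j≤k = contradiction (≤-trans (<⇒≤ i<j) j≤k) i≰k
maxChain-⊂ (suc n) c∈ {i} {suc j} (s≤s i≤j) (s≤s j≤n) | k , c , k∈ , c∈′ , refl | yes i≤k | no j≰k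
  rewrite insertAt-≤ {c = c} i≤k | insertAt-> {c = c} (≰⇒> j≰k) with m≤n⇒m<n∨m≡n i≤j
... | inj₁ i<j  = out⊂in (p⊂q⇒p⊆q (maxChain-⊂ n c∈′ i<j j≤n))
-- The chain gains the new point exactly between these two levels, so both sets have the same trace
-- on the old points.
... | inj₂ refl = out⊂in ⊆-refl
maxChain-⊂ (suc n) c∈ {zero}  {suc j} _         _         | k , c , k∈ , c∈′ , refl | no i≰k | no j≰k = contradiction z≤n i≰k
maxChain-⊂ (suc n) c∈ {suc i} {suc j} (s≤s i<j) (s≤s j≤n) | k , c , k∈ , c∈′ , refl | no i≰k | no j≰k
  rewrite insertAt-> {c = c} (≰⇒> i≰k) | insertAt-> {c = c} (≰⇒> j≰k) = s⊂s (maxChain-⊂ n c∈′ i<j j≤n)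

-- A maximal chain has one member of each size, so `A` lies on it exactly when `A` is its member of
-- size `∣ A ∣`.
Hit : (ℕ → Subset n) → Subset n → Set
Hit c A = c ∣ A ∣ ≡ A

hit? : ∀ (c : ℕ → Subset n) A → Dec (Hit c A)
hit? c A = Vec.≡-dec Bool._≟_ (c ∣ A ∣) A

hits? : ∀ (c : ℕ → Subset n) As → Dec (All (Hit c) As)
hits? c = All.all? (hit? c)

∑-maxChains-const : ∀ n k → ∑ (maxChains n) (λ _ → k) ≡ n ! * k
∑-maxChains-const zero    k = refl
∑-maxChains-const (suc n) k = begin
  ∑ (maxChains (suc n)) (λ _ → k)                     ≡⟨ ∑-cartesianProductWith insertAt (upTo (suc n)) (maxChains n) _ ⟩
  ∑< (suc n) (λ _ → ∑ (maxChains n) (λ _ → k))        ≡⟨ ∑-const (upTo (suc n)) _ ⟩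
  length (upTo (suc n)) * ∑ (maxChains n) (λ _ → k)   ≡⟨ cong₂ _*_ (length-upTo (suc n)) (∑-maxChains-const n k) ⟩
  suc n * (n ! * k)                                   ≡⟨ *-assoc (suc n) (n !) k ⟨
  suc n * n ! * k                                     ∎
  where open ≡-Reasoning

k∸a≤∑⟦a≤i⟧ : ∀ a k → k ∸ a ≤ ∑< k (λ i → ⟦ a ≤? i ⟧)
k∸a≤∑⟦a≤i⟧ a zero    = ≤-reflexive (0∸n≡0 a)
k∸a≤∑⟦a≤i⟧ a (suc k) = ≤-trans step (≤-reflexive (sym (∑<-suc k _)))
  where
  step : suc k ∸ a ≤ ∑< k (λ i → ⟦ a ≤? i ⟧) + ⟦ a ≤? k ⟧
  step with a ≤? k
  ... | yes a≤k = ≤-trans (≤-reflexive (trans (+-∸-assoc 1 a≤k) (+-comm 1 (k ∸ a))))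
                    (+-mono-≤ (k∸a≤∑⟦a≤i⟧ a k) (≤-reflexive (sym (⟦⟧-true (a ≤? k) a≤k))))
  ... | no  a≰k = ≤-trans (≤-reflexive (m≤n⇒m∸n≡0 (≰⇒> a≰k))) z≤n

1+a≤∑⟦i≤a⟧ : ∀ {a k} → a < k → suc a ≤ ∑< k (λ i → ⟦ i ≤? a ⟧)
1+a≤∑⟦i≤a⟧ {a} {k} a<k = begin
  suc a                                                     ≡⟨ length-upTo (suc a) ⟨
  length (upTo (suc a))                                     ≡⟨ ∑-1 (upTo (suc a)) ⟨
  ∑< (suc a) (λ _ → 1)
    ≡⟨ ∑-cong (upTo (suc a)) (λ {i} i∈ → sym (⟦⟧-true (i ≤? a) (s≤s⁻¹ (∈-upTo⁻ i∈)))) ⟩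
  ∑< (suc a) (λ i → ⟦ i ≤? a ⟧)                             ≤⟨ m≤m+n _ _ ⟩
  ∑< (suc a) (λ i → ⟦ i ≤? a ⟧) + ∑< (k ∸ suc a) (λ j → ⟦ suc a + j ≤? a ⟧)
                                                            ≡⟨ ∑<-+ (suc a) (k ∸ suc a) (λ i → ⟦ i ≤? a ⟧) ⟨
  ∑< (suc a + (k ∸ suc a)) (λ i → ⟦ i ≤? a ⟧)               ≡⟨ cong (λ z → ∑< z (λ i → ⟦ i ≤? a ⟧)) (m+[n∸m]≡n a<k) ⟩
  ∑< k (λ i → ⟦ i ≤? a ⟧)                                   ∎
  where open ≤-Reasoning

-- Induction on `k` proves the sharper bound `k ⊓ suc h ∸ l`, which grows by 1 exactly when `k` lies
-- in the window.
∑⟦l≤i≤h⟧≤ : ∀ l h k → ∑< k (λ i → ⟦ (l ≤? i) ×-dec (i ≤? h) ⟧) ≤ suc h ∸ l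
∑⟦l≤i≤h⟧≤ l h k = ≤-trans (bound k) (∸-monoˡ-≤ l (m⊓n≤n k (suc h)))
  where
  open ≤-Reasoning
  g = λ i → ⟦ (l ≤? i) ×-dec (i ≤? h) ⟧
  last : ∀ k → g k ≤ (suc k ⊓ suc h ∸ l) ∸ (k ⊓ suc h ∸ l)
  last k with (l ≤? k) ×-dec (k ≤? h)
  ... | no  ¬l≤k≤h      = ≤-trans (≤-reflexive (⟦⟧-false ((l ≤? k) ×-dec (k ≤? h)) ¬l≤k≤h)) z≤n
  ... | yes (l≤k , k≤h) = ≤-trans (⟦⟧-≤1 ((l ≤? k) ×-dec (k ≤? h))) (≤-reflexive (sym (begin-equality
    (suc k ⊓ suc h ∸ l) ∸ (k ⊓ suc h ∸ l)
      ≡⟨ cong₂ (λ x y → x ∸ l ∸ (y ∸ l)) (m≤n⇒m⊓n≡m (s≤s k≤h)) (m≤n⇒m⊓n≡m (m≤n⇒m≤1+n k≤h)) ⟩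
    (suc k ∸ l) ∸ (k ∸ l)     ≡⟨ cong (_∸ (k ∸ l)) (+-∸-assoc 1 l≤k) ⟩
    suc (k ∸ l) ∸ (k ∸ l)     ≡⟨ m+n∸n≡m 1 (k ∸ l) ⟩
    1                         ∎)))
  bound : ∀ k → ∑< k g ≤ k ⊓ suc h ∸ l
  bound zero    = z≤n
  bound (suc k) = begin
    ∑< (suc k) g                                                   ≡⟨ ∑<-suc k g ⟩
    ∑< k g + g k                                                   ≤⟨ +-mono-≤ (bound k) (last k) ⟩
    (k ⊓ suc h ∸ l) + ((suc k ⊓ suc h ∸ l) ∸ (k ⊓ suc h ∸ l))      ≡⟨ m+[n∸m]≡n (∸-monoˡ-≤ l (⊓-monoˡ-≤ (suc h) (n≤1+n k))) ⟩
    suc k ⊓ suc h ∸ l                                              ∎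

∑-insert-* : ∀ n (f : ℕ → ℕ) (g : (ℕ → Subset n) → ℕ) →
             ∑< (suc n) (λ i → ∑ (maxChains n) (λ c → f i * g c)) ≡ ∑< (suc n) f * ∑ (maxChains n) g
∑-insert-* n f g = trans (∑-cong (upTo (suc n)) (λ {i} _ → ∑-*ˡ (maxChains n) (f i) g))
                        (∑-*ʳ (upTo (suc n)) (∑ (maxChains n) g) f)

-- A chain of the old points through `A` still runs through `outside ∷ A` after an insertion at any
-- of the `suc n ∸ a` levels from `a` on, and through `inside ∷ A` after one at any of the `suc a`
-- levels up to `a`.
maxChains-through≥ : ∀ {n} (A : Subset n) → ∣ A ∣ ! * (n ∸ ∣ A ∣) ! ≤ ∑ (maxChains n) (λ c → ⟦ hit? c A ⟧)
maxChains-through≥ Vec.[] = ≤-refl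
maxChains-through≥ {suc n} (false Vec.∷ A) = begin
  a ! * (suc n ∸ a) !                                       ≡⟨ cong (λ z → a ! * z !) (+-∸-assoc 1 (∣p∣≤n A)) ⟩
  a ! * (suc (n ∸ a) * (n ∸ a) !)
    ≡⟨ x∙yz≈y∙xz *-commutativeSemigroup (a !) (suc (n ∸ a)) ((n ∸ a) !) ⟩
  suc (n ∸ a) * (a ! * (n ∸ a) !)                           ≡⟨ cong (_* (a ! * (n ∸ a) !)) (+-∸-assoc 1 (∣p∣≤n A)) ⟨
  (suc n ∸ a) * (a ! * (n ∸ a) !)                           ≤⟨ *-mono-≤ (k∸a≤∑⟦a≤i⟧ a (suc n)) (maxChains-through≥ A) ⟩
  ∑< (suc n) (λ i → ⟦ a ≤? i ⟧) * ∑ (maxChains n) (λ c → ⟦ hit? c A ⟧)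
                                                            ≡⟨ ∑-insert-* n (λ i → ⟦ a ≤? i ⟧) (λ c → ⟦ hit? c A ⟧) ⟨
  ∑< (suc n) (λ i → ∑ (maxChains n) (λ c → ⟦ a ≤? i ⟧ * ⟦ hit? c A ⟧))
    ≤⟨ ∑-mono (upTo (suc n)) (λ {i} _ → ∑-mono (maxChains n) λ {c} _ →
         ≤-trans (≤-reflexive (sym (⟦⟧-× (a ≤? i) (hit? c A))))
           (⟦⟧-mono ((a ≤? i) ×-dec hit? c A) (hit? (insertAt i c) (outside Vec.∷ A))
             λ (a≤i , h) → trans (insertAt-≤ {c = c} a≤i) (cong (outside Vec.∷_) h))) ⟩
  ∑< (suc n) (λ i → ∑ (maxChains n) (λ c → ⟦ hit? (insertAt i c) (outside Vec.∷ A) ⟧))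
    ≡⟨ ∑-cartesianProductWith insertAt (upTo (suc n)) (maxChains n) _ ⟨
  ∑ (maxChains (suc n)) (λ c → ⟦ hit? c (outside Vec.∷ A) ⟧) ∎
  where
  open ≤-Reasoning
  a = ∣ A ∣
maxChains-through≥ {suc n} (true Vec.∷ A) = begin
  suc a * a ! * (n ∸ a) !                                   ≡⟨ *-assoc (suc a) (a !) ((n ∸ a) !) ⟩
  suc a * (a ! * (n ∸ a) !)                                 ≤⟨ *-mono-≤ (1+a≤∑⟦i≤a⟧ (s≤s (∣p∣≤n A))) (maxChains-through≥ A) ⟩
  ∑< (suc n) (λ i → ⟦ i ≤? a ⟧) * ∑ (maxChains n) (λ c → ⟦ hit? c A ⟧)
                                                            ≡⟨ ∑-insert-* n (λ i → ⟦ i ≤? a ⟧) (λ c → ⟦ hit? c A ⟧) ⟨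
  ∑< (suc n) (λ i → ∑ (maxChains n) (λ c → ⟦ i ≤? a ⟧ * ⟦ hit? c A ⟧))
    ≤⟨ ∑-mono (upTo (suc n)) (λ {i} _ → ∑-mono (maxChains n) λ {c} _ →
         ≤-trans (≤-reflexive (sym (⟦⟧-× (i ≤? a) (hit? c A))))
           (⟦⟧-mono ((i ≤? a) ×-dec hit? c A) (hit? (insertAt i c) (inside Vec.∷ A))
             λ (i≤a , h) → trans (insertAt-> {c = c} (s≤s i≤a)) (cong (inside Vec.∷_) h))) ⟩
  ∑< (suc n) (λ i → ∑ (maxChains n) (λ c → ⟦ hit? (insertAt i c) (inside Vec.∷ A) ⟧))
    ≡⟨ ∑-cartesianProductWith insertAt (upTo (suc n)) (maxChains n) _ ⟨
  ∑ (maxChains (suc n)) (λ c → ⟦ hit? c (inside Vec.∷ A) ⟧) ∎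
  where
  open ≤-Reasoning
  a = ∣ A ∣

-- Upper bound for the maximal chains through nested sets

sizes : List (Subset n) → List ℕ
sizes = map ∣_∣

outs ins : List (Subset n) → List (Subset (suc n))
outs = map (outside Vec.∷_)
ins  = map (inside Vec.∷_)

-- Once a member of an increasing list contains the first point, so do all later ones. Two members
-- may coincide after the point is dropped, hence `_⊆_` instead of `_⊂_`.
splitAtPoint : (As : List (Subset (suc n))) → Linked _⊆_ As →
        ∃₂ λ Xs Ys → As ≡ outs Xs ++ ins Ys × Linked _⊆_ (Xs ++ Ys)
splitAtPoint []                       _   = [] , [] , refl , []
splitAtPoint ((false Vec.∷ A) ∷ [])   _   = A ∷ [] , [] , refl , [-]
splitAtPoint ((true  Vec.∷ A) ∷ [])   _   = [] , A ∷ [] , refl , [-]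
splitAtPoint ((false Vec.∷ A) ∷ B ∷ Bs) (A⊆B ∷ l) with splitAtPoint (B ∷ Bs) l
... | X ∷ Xs , Ys , refl , l′      = A ∷ X ∷ Xs , Ys , refl , drop-∷-⊆ A⊆B ∷ l′
... | [] , Y ∷ Ys , refl , l′      = A ∷ [] , Y ∷ Ys , refl , drop-∷-⊆ A⊆B ∷ l′
splitAtPoint ((true  Vec.∷ A) ∷ B ∷ Bs) (A⊆B ∷ l) with splitAtPoint (B ∷ Bs) l
... | X ∷ Xs , Ys , refl , l′      = contradiction (A⊆B Vec.here) λ ()
... | [] , Y ∷ Ys , refl , l′      = [] , A ∷ Y ∷ Ys , refl , drop-∷-⊆ A⊆B ∷ l′

firstOr : ℕ → List ℕ → ℕ
firstOr n []       = n
firstOr n (b ∷ bs) = b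

gaps!-suc : ∀ n p bs → gaps! (suc n) (suc p) (map suc bs) ≡ gaps! n p bs
gaps!-suc n p []       = refl
gaps!-suc n p (b ∷ bs) = cong ((b ∸ p) ! *_) (gaps!-suc n b bs)

[1+b∸p]*[b∸p]!≤ : ∀ b p → (suc b ∸ p) * (b ∸ p) ! ≤ (suc b ∸ p) !
[1+b∸p]*[b∸p]!≤ b p with p ≤? b
... | yes p≤b rewrite +-∸-assoc 1 p≤b = ≤-refl
... | no  p≰b rewrite m≤n⇒m∸n≡0 (≰⇒> p≰b) = z≤n

-- Inserting a point between the last of `as` and the first of `bs` lengthens that one gap by 1 and
-- multiplies its factorial by the new length. All other gaps keep their lengths, because the sizes
-- above it and `n` shift together.
gaps!-insert : ∀ n p as bs → (suc (firstOr n bs) ∸ lastOr p as) * gaps! n p (as ++ bs) ≤ gaps! (suc n) p (as ++ map suc bs)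
gaps!-insert n p [] []       = [1+b∸p]*[b∸p]!≤ n p
gaps!-insert n p [] (b ∷ bs) = begin
  (suc b ∸ p) * ((b ∸ p) ! * gaps! n b bs)   ≡⟨ *-assoc (suc b ∸ p) ((b ∸ p) !) _ ⟨
  (suc b ∸ p) * (b ∸ p) ! * gaps! n b bs     ≤⟨ *-mono-≤ ([1+b∸p]*[b∸p]!≤ b p) (≤-reflexive (sym (gaps!-suc n b bs))) ⟩
  (suc b ∸ p) ! * gaps! (suc n) (suc b) (map suc bs) ∎
  where open ≤-Reasoning
gaps!-insert n p (a ∷ as) bs =
  ≤-trans (≤-reflexive (x∙yz≈y∙xz *-commutativeSemigroup (suc (firstOr n bs) ∸ lastOr a as) ((a ∸ p) !) _))
          (*-monoʳ-≤ ((a ∸ p) !) (gaps!-insert n a as bs))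

0<gaps! : ∀ n p as → 0 < gaps! n p as
0<gaps! n p []       = 1≤n! (n ∸ p)
0<gaps! n p (a ∷ as) = *-mono-≤ (1≤n! (a ∸ p)) (0<gaps! n a as)

-- The first coordinate of the set reveals on which side of the insertion level its size lies.
hit-out : ∀ {i} {c : ℕ → Subset n} {A} → Hit (insertAt i c) (outside Vec.∷ A) → ∣ A ∣ ≤ i × Hit c A
hit-out {i = i} {c} {A} h with ∣ A ∣ ≤? i
... | yes a≤i = a≤i , Vec.∷-injectiveʳ (trans (sym (insertAt-≤ {c = c} a≤i)) h)
... | no  a≰i = contradiction (Vec.∷-injectiveˡ (trans (sym (insertAt-> {c = c} (≰⇒> a≰i))) h)) λ ()

hit-in : ∀ {i} {c : ℕ → Subset n} {A} → Hit (insertAt i c) (inside Vec.∷ A) → i ≤ ∣ A ∣ × Hit c A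
hit-in {i = i} {c} {A} h with suc ∣ A ∣ ≤? i
... | yes a<i = contradiction (Vec.∷-injectiveˡ (trans (sym (insertAt-≤ {c = c} a<i)) h)) λ ()
... | no  a≮i = s≤s⁻¹ (≰⇒> a≮i) , Vec.∷-injectiveʳ (trans (sym (insertAt-> {c = c} (≰⇒> a≮i))) h)

lastOr≤ : ∀ {i p} {Xs : List (Subset n)} → p ≤ i → All (λ A → ∣ A ∣ ≤ i) Xs → lastOr p (sizes Xs) ≤ i
lastOr≤ p≤i []           = p≤i
lastOr≤ _   (a≤i ∷ as≤i) = lastOr≤ a≤i as≤i

≤firstOr : ∀ {i} {Ys : List (Subset n)} → i ≤ n → All (λ A → i ≤ ∣ A ∣) Ys → i ≤ firstOr n (sizes Ys)
≤firstOr i≤n []        = i≤n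
≤firstOr _   (i≤b ∷ _) = i≤b

-- Induction on `n`: a maximal chain through `As` restricts to one through the traces on the old
-- points, and its insertion level lies between the last size of `Xs` and the first trace size of
-- `Ys`. The number of such levels is the factor in `gaps!-insert`.
maxChains-through≤ : ∀ n (As : List (Subset n)) → Linked _⊆_ As →
                     ∑ (maxChains n) (λ c → ⟦ hits? c As ⟧) ≤ gaps! n 0 (sizes As)
maxChains-through≤ zero    As _ =
  ≤-trans (≤-reflexive (+-identityʳ _)) (≤-trans (⟦⟧-≤1 (hits? _ As)) (0<gaps! 0 0 (sizes As)))
maxChains-through≤ (suc n) As l with splitAtPoint As l
... | Xs , Ys , refl , l′ = begin
  ∑ (maxChains (suc n)) (λ c → ⟦ hits? c As ⟧)
    ≡⟨ ∑-cartesianProductWith insertAt (upTo (suc n)) (maxChains n) _ ⟩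
  ∑< (suc n) (λ i → ∑ (maxChains n) (λ c → ⟦ hits? (insertAt i c) As ⟧))
    ≤⟨ ∑-mono (upTo (suc n)) (λ {i} i∈ → ∑-mono (maxChains n) λ {c} _ →
         ≤-trans (⟦⟧-mono (hits? (insertAt i c) As) (R? i ×-dec hits? c (Xs ++ Ys)) (restrict {i} {c} (s≤s⁻¹ (∈-upTo⁻ i∈))))
           (≤-reflexive (⟦⟧-× (R? i) (hits? c (Xs ++ Ys))))) ⟩
  ∑< (suc n) (λ i → ∑ (maxChains n) (λ c → ⟦ R? i ⟧ * ⟦ hits? c (Xs ++ Ys) ⟧))
    ≡⟨ ∑-insert-* n (λ i → ⟦ R? i ⟧) (λ c → ⟦ hits? c (Xs ++ Ys) ⟧) ⟩
  ∑< (suc n) (λ i → ⟦ R? i ⟧) * ∑ (maxChains n) (λ c → ⟦ hits? c (Xs ++ Ys) ⟧)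
    ≤⟨ *-mono-≤ (∑⟦l≤i≤h⟧≤ lo hi (suc n)) (maxChains-through≤ n (Xs ++ Ys) l′) ⟩
  (suc hi ∸ lo) * gaps! n 0 (sizes (Xs ++ Ys))
    ≡⟨ cong (λ as → (suc hi ∸ lo) * gaps! n 0 as) (map-++ ∣_∣ Xs Ys) ⟩
  (suc hi ∸ lo) * gaps! n 0 (sizes Xs ++ sizes Ys)
    ≤⟨ gaps!-insert n 0 (sizes Xs) (sizes Ys) ⟩
  gaps! (suc n) 0 (sizes Xs ++ map suc (sizes Ys))
    ≡⟨ cong (gaps! (suc n) 0) (trans (map-++ ∣_∣ (outs Xs) (ins Ys))
         (cong₂ _++_ (sym (map-∘ Xs)) (trans (sym (map-∘ Ys)) (map-∘ Ys)))) ⟨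
  gaps! (suc n) 0 (sizes As) ∎
  where
  open ≤-Reasoning
  -- If no set constrains the insertion level from one side, the bounds default to the extreme
  -- levels 0 and `n`.
  lo = lastOr 0 (sizes Xs)
  hi = firstOr n (sizes Ys)
  R? = λ i → (lo ≤? i) ×-dec (i ≤? hi)
  restrict : ∀ {i c} → i ≤ n → All (Hit (insertAt i c)) (outs Xs ++ ins Ys) → (lo ≤ i × i ≤ hi) × All (Hit c) (Xs ++ Ys)
  restrict {i} {c} i≤n hs with All.++⁻ (outs Xs) hs
  ... | hxs , hys =
    (lastOr≤ z≤n (All.map (proj₁ ∘ hit-out {i = i} {c}) hxs′) ,
     ≤firstOr i≤n (All.map (proj₁ ∘ hit-in {i = i} {c}) hys′)) ,
    All.++⁺ (All.map (proj₂ ∘ hit-out {i = i} {c}) hxs′) (All.map (proj₂ ∘ hit-in {i = i} {c}) hys′)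
    where
    hxs′ = All.map⁻ hxs
    hys′ = All.map⁻ hys

-- Sublists of fixed length

sublists : ∀ k → List A → List (Vec A k)
sublists zero    xs       = Vec.[] ∷ []
sublists (suc k) []       = []
sublists (suc k) (x ∷ xs) = map (x Vec.∷_) (sublists k xs) ++ sublists (suc k) xs

sublists-All : ∀ k {P : Pred A ℓ} {xs T} → All P xs → T ∈ sublists k xs → VAll.All P T
sublists-All zero    _ (here refl) = []
sublists-All (suc k) {xs = x ∷ xs} (px ∷ pxs) T∈ with ∈-++⁻ (map (x Vec.∷_) (sublists k xs)) T∈
... | inj₂ T∈′ = sublists-All (suc k) pxs T∈′
... | inj₁ T∈′ with ∈-map⁻ (x Vec.∷_) T∈′
...   | U , U∈ , refl = px ∷ sublists-All k pxs U∈

sublists-Linked : ∀ k {xs T} → AllPairs R xs → T ∈ sublists {A = A} k xs → VLinked.Linked R T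
sublists-Linked zero    _ (here refl) = VLinked.[]
sublists-Linked (suc k) {xs = x ∷ xs} (rx ∷ rxs) T∈ with ∈-++⁻ (map (x Vec.∷_) (sublists k xs)) T∈
... | inj₂ T∈′ = sublists-Linked (suc k) rxs T∈′
... | inj₁ T∈′ with ∈-map⁻ (x Vec.∷_) T∈′
...   | Vec.[] , U∈ , refl = VLinked.[-]
...   | U@(_ Vec.∷ _) , U∈ , refl = VAll.head (sublists-All k rx U∈) VLinked.∷ sublists-Linked k rxs U∈

sublists-Unique : ∀ k {xs : List A} → Unique xs → Unique (sublists k xs)
sublists-Unique zero    _ = [] ∷ []
sublists-Unique (suc k) [] = []
sublists-Unique (suc k) {x ∷ xs} (x∉xs ∷ uxs) =
  Unique.++⁺ (Unique.map⁺ Vec.∷-injectiveʳ (sublists-Unique k uxs)) (sublists-Unique (suc k) uxs) disjoint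
  where
  disjoint : ∀ {T} → ¬ (T ∈ map (x Vec.∷_) (sublists k xs) × T ∈ sublists (suc k) xs)
  disjoint (T∈ , T∈′) with ∈-map⁻ (x Vec.∷_) T∈
  ... | U , _ , refl = VAll.head (sublists-All (suc k) x∉xs T∈′) refl

-- For N satisfying entries this reads N ≤ (N choose m+1) + m. If the head `x` satisfies `P`, the
-- tail is handled with `m` lowered by 1, and the sublists counted there are extended by `x`. For
-- `m = 0` the head itself is the additional sublist.
count≤count-sublists : ∀ {P : Pred A ℓ} (P? : Decidable P) m xs →
  ∑ xs (λ x → ⟦ P? x ⟧) ≤ ∑ (sublists (suc m) xs) (λ T → ⟦ All.all? P? (toList T) ⟧) + m
count≤count-sublists P? m []       = z≤n
count≤count-sublists {A = A} P? m (x ∷ xs) with P? x in eq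
... | no  _  = begin
  ∑ xs (λ x → ⟦ P? x ⟧)                             ≤⟨ count≤count-sublists P? m xs ⟩
  ∑ (sublists (suc m) xs) all + m                       ≤⟨ +-monoˡ-≤ m (m≤n+m _ _) ⟩
  ∑ (map (x Vec.∷_) (sublists m xs)) all + ∑ (sublists (suc m) xs) all + m
                                                    ≡⟨ cong (_+ m) (∑-++ (map (x Vec.∷_) (sublists m xs)) all) ⟨
  ∑ (sublists (suc m) (x ∷ xs)) all + m                 ∎
  where
  open ≤-Reasoning
  all : ∀ {k} → Vec A k → ℕ
  all T = ⟦ All.all? P? (toList T) ⟧
... | yes px = begin
  1 + ∑ xs (λ x → ⟦ P? x ⟧)                         ≤⟨ with-x m ⟩
  ∑ (map (x Vec.∷_) (sublists m xs)) all + ∑ (sublists (suc m) xs) all + m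
                                                    ≡⟨ cong (_+ m) (∑-++ (map (x Vec.∷_) (sublists m xs)) all) ⟨
  ∑ (sublists (suc m) (x ∷ xs)) all + m                 ∎
  where
  open ≤-Reasoning
  all : ∀ {k} → Vec A k → ℕ
  all T = ⟦ All.all? P? (toList T) ⟧
  prepend : ∀ m → ∑ (sublists m xs) all ≤ ∑ (map (x Vec.∷_) (sublists m xs)) all
  prepend m = ≤-trans
    (∑-mono (sublists m xs) λ {T} _ → ⟦⟧-mono (All.all? P? (toList T)) (All.all? P? (x ∷ toList T)) (px ∷_))
    (≤-reflexive (sym (∑-map (x Vec.∷_) (sublists m xs) all)))
  with-x : ∀ m → 1 + ∑ xs (λ x → ⟦ P? x ⟧) ≤
                 ∑ (map (x Vec.∷_) (sublists m xs)) all + ∑ (sublists (suc m) xs) all + m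
  with-x zero    = ≤-trans (+-mono-≤ (prepend 0) (count≤count-sublists P? 0 xs))
                           (≤-reflexive (sym (+-assoc (∑ (map (x Vec.∷_) (sublists 0 xs)) all) _ 0)))
  with-x (suc m) = begin
    1 + ∑ xs (λ x → ⟦ P? x ⟧)                                  ≤⟨ s≤s (count≤count-sublists P? m xs) ⟩
    1 + (∑ (sublists (suc m) xs) all + m)                          ≡⟨ +-suc (∑ (sublists (suc m) xs) all) m ⟨
    ∑ (sublists (suc m) xs) all + suc m
      ≤⟨ +-monoˡ-≤ (suc m) (≤-trans (prepend (suc m)) (m≤m+n _ _)) ⟩
    ∑ (map (x Vec.∷_) (sublists (suc m) xs)) all + ∑ (sublists (suc (suc m)) xs) all + suc m ∎

-- Slicing weights into unit layers

w≤layers+[w∸t] : ∀ w t → w ≤ ∑< t (λ s → ⟦ s <? w ⟧) + (w ∸ t)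
w≤layers+[w∸t] w zero    = ≤-refl
w≤layers+[w∸t] w (suc t) = ≤-trans (w≤layers+[w∸t] w t) (≤-trans (step (t <? w))
  (≤-reflexive (cong (_+ (w ∸ suc t)) (sym (∑<-suc t _)))))
  where
  -- `S` is the minimum of `w` and `t`, counted layer by layer.
  S = ∑< t (λ s → ⟦ s <? w ⟧)
  step : Dec (t < w) → S + (w ∸ t) ≤ S + ⟦ t <? w ⟧ + (w ∸ suc t)
  step (yes t<w) = ≤-reflexive (trans
    (cong (S +_) (trans (+-∸-assoc 1 t<w) (cong (_+ (w ∸ suc t)) (sym (⟦⟧-true (t <? w) t<w)))))
    (sym (+-assoc S _ _)))
  step (no  t≮w) = ≤-trans
    (≤-reflexive (trans (cong (S +_) (m≤n⇒m∸n≡0 (≮⇒≥ t≮w))) (+-identityʳ S)))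
    (≤-trans (m≤m+n S _) (m≤m+n _ _))

layers≤w : ∀ w t → ∑< t (λ s → ⟦ s <? w ⟧) ≤ w
layers≤w zero    t = ≤-reflexive (∑-zero (upTo t) λ {s} _ → ⟦⟧-false (s <? 0) λ ())
layers≤w (suc w) t = ≤-trans
  (∑-mono (upTo t) λ {s} _ → ⟦⟧-mono (s <? suc w) ((0 ≤? s) ×-dec (s ≤? w)) λ s<1+w → z≤n , s≤s⁻¹ s<1+w)
  (∑⟦l≤i≤h⟧≤ 0 w t)

-- The minimum of t and the weights of the entries.
layers : (A → ℕ) → ℕ → List A → ℕ
layers v t xs = ∑< t (λ s → ⟦ All.all? (λ x → s <? v x) xs ⟧)

layers≤v : ∀ (v : A → ℕ) t xs → All (λ x → layers v t xs ≤ v x) xs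
layers≤v v t xs = All.tabulate λ {x} x∈xs → ≤-trans
  (∑-mono (upTo t) (λ {s} _ → ⟦⟧-mono (All.all? (λ x → s <? v x) xs) (s <? v x) λ all → All.lookup all x∈xs))
  (layers≤w (v x) t)

-- At each of the `t` layers the entries heavier than `s` are counted by `count≤count-sublists`, at
-- a cost of `m` per layer. Only the excess of the weights over `t` remains unsliced.
∑≤∑-sublists-layers : ∀ (v : A → ℕ) t m xs →
  ∑ xs v ≤ ∑ (sublists (suc m) xs) (λ T → layers v t (toList T)) + (t * m + ∑ xs (λ x → v x ∸ t))
∑≤∑-sublists-layers v t m xs = begin
  ∑ xs v
    ≤⟨ ∑-mono xs (λ {x} _ → w≤layers+[w∸t] (v x) t) ⟩
  ∑ xs (λ x → ∑< t (λ s → ⟦ s <? v x ⟧) + (v x ∸ t))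
    ≡⟨ ∑-+ xs (λ x → ∑< t (λ s → ⟦ s <? v x ⟧)) (λ x → v x ∸ t) ⟩
  ∑ xs (λ x → ∑< t (λ s → ⟦ s <? v x ⟧)) + E
    ≡⟨ cong (_+ E) (∑-swap xs (upTo t) (λ x s → ⟦ s <? v x ⟧)) ⟩
  ∑< t (λ s → ∑ xs (λ x → ⟦ s <? v x ⟧)) + E
    ≤⟨ +-monoˡ-≤ E (∑-mono (upTo t) (λ {s} _ → count≤count-sublists (λ x → s <? v x) m xs)) ⟩
  ∑< t (λ s → ∑ (sublists (suc m) xs) (h s) + m) + E
    ≡⟨ cong (_+ E) (trans (∑-+ (upTo t) (λ s → ∑ (sublists (suc m) xs) (h s)) (λ _ → m))
         (cong₂ _+_ (∑-swap (upTo t) (sublists (suc m) xs) h) (trans (∑-const (upTo t) m) (cong (_* m) (length-upTo t))))) ⟩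
  ∑ (sublists (suc m) xs) (λ T → layers v t (toList T)) + t * m + E
    ≡⟨ +-assoc (∑ (sublists (suc m) xs) (λ T → layers v t (toList T))) (t * m) E ⟩
  ∑ (sublists (suc m) xs) (λ T → layers v t (toList T)) + (t * m + E) ∎
  where
  open ≤-Reasoning
  E = ∑ xs (λ x → v x ∸ t)
  h : ℕ → Vec _ (suc m) → ℕ
  h s T = ⟦ All.all? (λ x → s <? v x) (toList T) ⟧

-- Membership in `chains`

tuples-∈⁺ : ∀ {k} {F : List A} {T : Vec A k} → VAll.All (_∈ F) T → T ∈ tuples k F
tuples-∈⁺ []         = here refl
tuples-∈⁺ (x∈ ∷ xs∈) = ∈-cartesianProductWith⁺ Vec._∷_ x∈ (tuples-∈⁺ xs∈)

tuples-∈⁻ : ∀ k (F : List A) {T : Vec A k} → T ∈ tuples k F → VAll.All (_∈ F) T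
tuples-∈⁻ zero    F (here refl) = []
tuples-∈⁻ (suc k) F T∈ with ∈-cartesianProductWith⁻ Vec._∷_ F (tuples k F) T∈
... | x , U , x∈ , U∈ , refl = x∈ ∷ tuples-∈⁻ k F U∈

tuples-Unique : ∀ k {F : List A} → Unique F → Unique (tuples k F)
tuples-Unique zero    uF = [] ∷ []
tuples-Unique (suc k) uF = Unique.cartesianProductWith⁺ Vec._∷_ Vec.∷-injective uF (tuples-Unique k uF)

chains-∈⁺ : ∀ {k} {F : List (Subset n)} {T : Vec (Subset n) k} → VAll.All (_∈ F) T → VLinked.Linked _⊂_ T → T ∈ chains k F
chains-∈⁺ T∈ l = ∈-filter⁺ (linked? _⊂?_) (tuples-∈⁺ T∈) l

chains-∈⁻ : ∀ k (F : List (Subset n)) {T : Vec (Subset n) k} → T ∈ chains k F → VAll.All (_∈ F) T × VLinked.Linked _⊂_ T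
chains-∈⁻ k F T∈ with ∈-filter⁻ (linked? _⊂?_) {xs = tuples k F} T∈
... | T∈′ , l = tuples-∈⁻ k F T∈′ , l

chains-Unique : ∀ k {F : List (Subset n)} → Unique F → Unique (chains k F)
chains-Unique k uF = Unique.filter⁺ (linked? _⊂?_) (tuples-Unique k uF)

-- Averaging over the maximal chains

_≟ˢ_ : (A B : Subset n) → Dec (A ≡ B)
_≟ˢ_ = Vec.≡-dec Bool._≟_

per-chain : ∀ {c} → c ∈ maxChains n → ∀ {F} → Unique F → ∀ t m →
  ∑ F (λ A → ⟦ hit? c A ⟧ * (n C ∣ A ∣)) ≤
  ∑ (chains (suc m) F) (λ T → ⟦ hits? c (toList T) ⟧ * layers (λ A → n C ∣ A ∣) t (toList T))
    + (t * m + ∑< (suc n) (λ i → n C i ∸ t))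
per-chain {n} {c} c∈ {F} uF t m = begin
  ∑ F (λ A → ⟦ hit? c A ⟧ * v A)               ≡⟨ ∑-filter (hit? c) F v ⟨
  ∑ (filter (hit? c) F) v                      ≤⟨ ∑-⊆ v (Unique.filter⁺ (hit? c) uF) F∩c⊆G ⟩
  ∑ G v                                        ≤⟨ ∑≤∑-sublists-layers v t m G ⟩
  ∑ (sublists (suc m) G) f + (t * m + ∑ G (λ A → v A ∸ t))
    ≤⟨ +-mono-≤ (∑-⊆ f (sublists-Unique (suc m) uG) sublists⊆chains)
         (+-monoʳ-≤ (t * m) rest) ⟩
  ∑ (filter (λ T → hits? c (toList T)) (chains (suc m) F)) f + (t * m + ∑< (suc n) (λ i → n C i ∸ t))
    ≡⟨ cong (_+ (t * m + ∑< (suc n) (λ i → n C i ∸ t)))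
         (∑-filter (λ T → hits? c (toList T)) (chains (suc m) F) f) ⟩
  ∑ (chains (suc m) F) (λ T → ⟦ hits? c (toList T) ⟧ * f T) + (t * m + ∑< (suc n) (λ i → n C i ∸ t)) ∎
  where
  open ≤-Reasoning
  v : Subset n → ℕ
  v A = n C ∣ A ∣
  f : Vec (Subset n) (suc m) → ℕ
  f T = layers v t (toList T)
  members = applyUpTo c (suc n)
  -- Selecting from the members of `c` in order of size makes the sublists of `G` strictly
  -- increasing, as entries of `chains` have to be.
  G = filter (λ A → member? _≟ˢ_ A F) members
  G-⊂ : AllPairs _⊂_ G
  G-⊂ = AllPairs.filter⁺ (λ A → member? _≟ˢ_ A F)
          (AllPairs.applyUpTo⁺₁ c (suc n) λ i<j j<1+n → maxChain-⊂ n c∈ i<j (s≤s⁻¹ j<1+n))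
  uG : Unique G
  uG = AllPairs.map (λ A⊂B A≡B → ⊂-irref A≡B A⊂B) G-⊂
  F∩c⊆G : ∀ {A} → A ∈ filter (hit? c) F → A ∈ G
  F∩c⊆G {A} A∈ with ∈-filter⁻ (hit? c) {xs = F} A∈
  ... | A∈F , h = ∈-filter⁺ (λ A → member? _≟ˢ_ A F) (subst (_∈ members) h (∈-applyUpTo⁺ c (s≤s (∣p∣≤n A)))) A∈F
  G∈F : All (_∈ F) G
  G∈F = All.tabulate λ A∈G → proj₂ (∈-filter⁻ (λ A → member? _≟ˢ_ A F) {xs = members} A∈G)
  G-hit : All (Hit c) G
  G-hit = All.tabulate hit
    where
    hit : ∀ {A} → A ∈ G → Hit c A
    hit A∈G with ∈-applyUpTo⁻ c (proj₁ (∈-filter⁻ (λ A → member? _≟ˢ_ A F) {xs = members} A∈G))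
    ... | i , i<1+n , refl = cong c (∣maxChain∣ n c∈ (s≤s⁻¹ i<1+n))
  sublists⊆chains : ∀ {T} → T ∈ sublists (suc m) G → T ∈ filter (λ T → hits? c (toList T)) (chains (suc m) F)
  sublists⊆chains T∈ = ∈-filter⁺ (λ T → hits? c (toList T))
    (chains-∈⁺ (sublists-All (suc m) G∈F T∈) (sublists-Linked (suc m) G-⊂ T∈)) (toList⁺ (sublists-All (suc m) G-hit T∈))
  rest : ∑ G (λ A → v A ∸ t) ≤ ∑< (suc n) (λ i → n C i ∸ t)
  rest = begin
    ∑ G (λ A → v A ∸ t)                     ≤⟨ ∑-filter-≤ (λ A → member? _≟ˢ_ A F) members _ ⟩
    ∑ members (λ A → v A ∸ t)               ≡⟨ cong (λ xs → ∑ xs (λ A → v A ∸ t)) (map-upTo c (suc n)) ⟨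
    ∑ (map c (upTo (suc n))) (λ A → v A ∸ t) ≡⟨ ∑-map c (upTo (suc n)) (λ A → v A ∸ t) ⟩
    ∑< (suc n) (λ i → v (c i) ∸ t)
      ≡⟨ ∑-cong (upTo (suc n)) (λ i∈ → cong (λ k → n C k ∸ t) (∣maxChain∣ n c∈ (s≤s⁻¹ (∈-upTo⁻ i∈)))) ⟩
    ∑< (suc n) (λ i → n C i ∸ t)            ∎

-- Double counting of pairs of a member of `F` and a maximal chain through it: with weight
-- `n C ∣ A ∣` every member contributes at least `n !`, whatever its size.
averaged : ∀ n {F : List (Subset n)} → Unique F → ∀ t m →
  n ! * length F ≤
  ∑ (chains (suc m) F) (λ T → ∑ (maxChains n) (λ c → ⟦ hits? c (toList T) ⟧) * layers (λ A → n C ∣ A ∣) t (toList T))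
    + n ! * (t * m + ∑< (suc n) (λ i → n C i ∸ t))
averaged n {F} uF t m = begin
  n ! * length F                                                 ≡⟨ *-comm (n !) (length F) ⟩
  length F * n !                                                 ≡⟨ ∑-const F (n !) ⟨
  ∑ F (λ _ → n !)                                                ≤⟨ ∑-mono F (λ {A} _ → through A) ⟩
  ∑ F (λ A → ∑ (maxChains n) (λ c → ⟦ hit? c A ⟧ * v A))          ≡⟨ ∑-swap F (maxChains n) (λ A c → ⟦ hit? c A ⟧ * v A) ⟩
  ∑ (maxChains n) (λ c → ∑ F (λ A → ⟦ hit? c A ⟧ * v A))          ≤⟨ ∑-mono (maxChains n) (λ c∈ → per-chain c∈ uF t m) ⟩
  ∑ (maxChains n) (λ c → ∑ (chains (suc m) F) (g c) + B)
    ≡⟨ ∑-+ (maxChains n) (λ c → ∑ (chains (suc m) F) (g c)) (λ _ → B) ⟩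
  ∑ (maxChains n) (λ c → ∑ (chains (suc m) F) (g c)) + ∑ (maxChains n) (λ _ → B)
    ≡⟨ cong₂ _+_ (trans (∑-swap (maxChains n) (chains (suc m) F) g)
                        (∑-cong (chains (suc m) F) λ {T} _ → ∑-*ʳ (maxChains n) (f T) (λ c → ⟦ hits? c (toList T) ⟧)))
                 (∑-maxChains-const n B) ⟩
  ∑ (chains (suc m) F) (λ T → ∑ (maxChains n) (λ c → ⟦ hits? c (toList T) ⟧) * f T) + n ! * B ∎
  where
  open ≤-Reasoning
  v : Subset n → ℕ
  v A = n C ∣ A ∣
  f : Vec (Subset n) (suc m) → ℕ
  f T = layers v t (toList T)
  g : (ℕ → Subset n) → Vec (Subset n) (suc m) → ℕ
  g c T = ⟦ hits? c (toList T) ⟧ * f T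
  B = t * m + ∑< (suc n) (λ i → n C i ∸ t)
  through : ∀ A → n ! ≤ ∑ (maxChains n) (λ c → ⟦ hit? c A ⟧ * v A)
  through A = begin
    n !                                            ≡⟨ nCk*k![n∸k]!≡n! (∣p∣≤n A) ⟨
    v A * (∣ A ∣ ! * (n ∸ ∣ A ∣) !)                 ≤⟨ *-monoʳ-≤ (v A) (maxChains-through≥ A) ⟩
    v A * ∑ (maxChains n) (λ c → ⟦ hit? c A ⟧)      ≡⟨ *-comm (v A) _ ⟩
    ∑ (maxChains n) (λ c → ⟦ hit? c A ⟧) * v A      ≡⟨ ∑-*ʳ (maxChains n) (v A) (λ c → ⟦ hit? c A ⟧) ⟨
    ∑ (maxChains n) (λ c → ⟦ hit? c A ⟧ * v A)      ∎

-- Families without spanning chains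

Spanning : ∀ {m} → Vec (Subset n) (suc m) → Set
Spanning {n} (A Vec.∷ As) = ∣ A ∣ ≡ 0 × lastOr ∣ A ∣ (sizes (toList As)) ≡ n

toList-Linked : ∀ {k} {T : Vec A k} → VLinked.Linked R T → Linked R (toList T)
toList-Linked VLinked.[]  = []
toList-Linked VLinked.[-] = [-]
toList-Linked {T = _ Vec.∷ _ Vec.∷ _} (r VLinked.∷ l) = r ∷ toList-Linked l

All-lastOr : ∀ {P : ℕ → Set} {A : Subset n} {As} → All (λ A → P ∣ A ∣) (A ∷ As) → P (lastOr ∣ A ∣ (sizes As))
All-lastOr (p ∷ [])             = p
All-lastOr {P = P} {As = B ∷ Bs} (_ ∷ ps) = All-lastOr {P = P} {B} {Bs} ps

sizes-Linked : ∀ {k} {T : Vec (Subset n) k} → VLinked.Linked _⊂_ T → Linked _<_ (sizes (toList T))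
sizes-Linked l = Linked.map⁺ (Linked.map p⊂q⇒∣p∣<∣q∣ (toList-Linked l))

length-sizes : ∀ {k} (T : Vec (Subset n) k) → length (sizes (toList T)) ≡ k
length-sizes T = trans (length-map ∣_∣ (toList T)) (Vec.length-toList T)

-- Spanning chains have to be excluded: for `n = 2` and `T` consisting of the empty and the full
-- set, with `t` positive, the left side is 2 · 1 · 2 and exceeds 2!.
coverage≤n! : ∀ {m} (T : Vec (Subset n) (suc m)) t → VLinked.Linked _⊂_ T → ¬ Spanning T →
  ∑ (maxChains n) (λ c → ⟦ hits? c (toList T) ⟧) * layers (λ A → n C ∣ A ∣) t (toList T) * falling ((n + suc m) / 2) m ≤ n !
coverage≤n! {n} {m} T@(A Vec.∷ As) t l ¬span = begin
  ∑ (maxChains n) (λ c → ⟦ hits? c (toList T) ⟧) * w * falling ((n + suc m) / 2) m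
    ≤⟨ *-monoˡ-≤ _ (*-monoˡ-≤ w (maxChains-through≤ n (toList T) (Linked.map p⊂q⇒p⊆q (toList-Linked l)))) ⟩
  gaps! n 0 (sizes (toList T)) * w * falling ((n + suc m) / 2) m
    ≡⟨ cong (λ k → gaps! n 0 (sizes (toList T)) * w * falling ((n + suc k) / 2) k) (length-sizes As) ⟨
  gaps! n 0 (sizes (toList T)) * w * falling ((n + suc (length as)) / 2) (length as)
    ≤⟨ gaps!*w*falling≤n! n ∣ A ∣ as w (sizes-Linked l) (All-lastOr {P = _≤ n} (All.universal ∣p∣≤n (toList T))) ¬span
         (All.head w≤) (All-lastOr {P = λ a → w ≤ n C a} w≤) ⟩
  n ! ∎
  where
  open ≤-Reasoning
  as = sizes (toList As)
  w  = layers (λ A → n C ∣ A ∣) t (toList T)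
  w≤ = layers≤v (λ A → n C ∣ A ∣) t (toList T)

≤⇒halves : ∀ {m n} → m ≤ n → ∃₂ λ q e → e ≤ 1 × n ≡ m + (q * 2 + e)
≤⇒halves {m} {n} m≤n with half (n ∸ m)
... | q , e , e≤1 , n∸m≡ = q , e , e≤1 , trans (sym (m+[n∸m]≡n m≤n)) (cong (m +_) n∸m≡)

-- This is the bound of the theorem with `length F` minus `Σ𝓑 n m` for `x`, the negative term moved
-- to the right so that all quantities are natural numbers.
nonspanning-supersaturation : ∀ n m → 1 ≤ n → m ≤ suc n → {F : List (Subset n)} → Unique F →
  (∀ {T} → T ∈ chains (suc m) F → ¬ Spanning T) →
  length F * falling ((n + suc m) / 2) m ≤ length (chains (suc m) F) + Σ𝓑 n m * falling ((n + suc m) / 2) m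
nonspanning-supersaturation n m 1≤n m≤1+n {F} uF ¬span with ≤⇒halves m≤1+n
... | q , e , e≤1 , 1+n≡ = *-cancelˡ-≤ (n !) {{n !≢0}} (begin
  n ! * (length F * D)                         ≡⟨ *-assoc (n !) (length F) D ⟨
  n ! * length F * D                           ≤⟨ *-monoˡ-≤ D (averaged n uF t m) ⟩
  (∑ Ch h + n ! * B) * D                       ≡⟨ *-distribʳ-+ D (∑ Ch h) (n ! * B) ⟩
  ∑ Ch h * D + n ! * B * D                     ≡⟨ cong₂ _+_ (sym (∑-*ʳ Ch D h)) (*-assoc (n !) B D) ⟩
  ∑ Ch (λ T → h T * D) + n ! * (B * D)
    ≤⟨ +-mono-≤ (∑-mono Ch λ {T} T∈ → coverage≤n! T t (proj₂ (chains-∈⁻ (suc m) F T∈)) (¬span T∈))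
         (*-monoʳ-≤ (n !) (*-monoˡ-≤ D B≤Σ)) ⟩
  ∑ Ch (λ _ → n !) + n ! * (Σ𝓑 n m * D)
    ≡⟨ cong (_+ n ! * (Σ𝓑 n m * D)) (trans (∑-const Ch (n !)) (*-comm (length Ch) (n !))) ⟩
  n ! * length Ch + n ! * (Σ𝓑 n m * D)         ≡⟨ *-distribˡ-+ (n !) (length Ch) (Σ𝓑 n m * D) ⟨
  n ! * (length Ch + Σ𝓑 n m * D)               ∎)
  where
  open ≤-Reasoning
  D  = falling ((n + suc m) / 2) m
  -- The coefficient at the lowest middle level: slicing up to this height lets `threshold` bound
  -- `B` by `Σ𝓑 n m`.
  t  = n C q
  B  = t * m + ∑< (suc n) (λ i → n C i ∸ t)
  Ch = chains (suc m) F
  B≤Σ : B ≤ Σ𝓑 n m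
  B≤Σ = ≤-trans (threshold n m q e e≤1 1+n≡) (≤-reflexive (sym (Σ𝓑≡ n m q e e≤1 1+n≡ 1≤n)))
  h : Vec (Subset n) (suc m) → ℕ
  h T = ∑ (maxChains n) (λ c → ⟦ hits? c (toList T) ⟧) * layers (λ A → n C ∣ A ∣) t (toList T)

-- For a family containing the empty set: the remaining sets number at least `Σ𝓑 n m + r`, so they
-- form at least `r` times the shorter product of chains with `suc m` members. This covers one full
-- copy of the longer product.
next-middle : ∀ n m → 1 ≤ n → m < n →
  ∃ λ r → falling ((n + suc (suc m)) / 2) (suc m) ≤ r * falling ((n + suc m) / 2) m × Σ𝓑 n m + r ≤ Σ𝓑 n (suc m)
next-middle n m 1≤n m<n with ≤⇒halves {suc m} {suc n} (m≤n⇒m≤1+n m<n)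
... | zero , zero , _ , 1+n≡ = contradiction (≤-trans (≤-reflexive 1+n≡) (s≤s (≤-reflexive (+-identityʳ m)))) (<⇒≱ (s≤s m<n))
-- The additional middle level is `q + m`, on top. The longer product starts one higher than the
-- shorter one, so their ratio is its first factor `suc h`.
... | q@(suc _) , zero , _ , refl = suc h , D≤ , (begin
    Σ𝓑 n m + suc h                         ≡⟨ cong (_+ suc h) (Σ𝓑≡ n m q 1 ≤-refl (lemma₁ m q) 1≤n) ⟩
    ∑< m (λ j → n C (q + j)) + suc h
      ≤⟨ +-monoʳ-≤ _ (≤-trans (a<[a+b]Ca h q (s≤s z≤n)) (≤-reflexive (cong (_C h) (lemma₂ m q)))) ⟩
    ∑< m (λ j → n C (q + j)) + n C (q + m) ≡⟨ ∑<-suc m (λ j → n C (q + j)) ⟨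
    ∑< (suc m) (λ j → n C (q + j))         ≡⟨ Σ𝓑≡ n (suc m) q 0 z≤n refl 1≤n ⟨
    Σ𝓑 n (suc m)                           ∎)
  where
  open ≤-Reasoning
  h = q + m
  lemma₁ : ∀ m q → suc m + (q * 2 + 0) ≡ m + (q * 2 + 1)
  lemma₁ = solve-∀
  lemma₂ : ∀ m q → q + m + q ≡ m + (q * 2 + 0)
  lemma₂ = solve-∀
  lemma₃ : ∀ m q → m + (q * 2 + 0) + suc (suc m) ≡ suc (q + m) * 2 + 0
  lemma₃ = solve-∀
  lemma₄ : ∀ m q → m + (q * 2 + 0) + suc m ≡ (q + m) * 2 + 1
  lemma₄ = solve-∀
  D≤ : falling ((n + suc (suc m)) / 2) (suc m) ≤ suc h * falling ((n + suc m) / 2) m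
  D≤ = ≤-reflexive (begin-equality
    falling ((n + suc (suc m)) / 2) (suc m)
      ≡⟨ cong (λ N → falling N (suc m)) (trans (cong (_/ 2) (lemma₃ m q)) ([q*2+e]/2≡q (suc h) z≤n)) ⟩
    falling (suc h) (suc m)                   ≡⟨ falling-suc h m ⟩
    suc h * falling h m
      ≡⟨ cong (λ N → suc h * falling N m) (trans (cong (_/ 2) (lemma₄ m q)) ([q*2+e]/2≡q h ≤-refl)) ⟨
    suc h * falling ((n + suc m) / 2) m       ∎)
-- The additional middle level is `q`, at the bottom. Both products start at `suc h`, so their ratio
-- is the last factor, `suc q`.
... | q , suc zero , _ , refl = suc q , D≤ , (begin
    Σ𝓑 n m + suc q                             ≡⟨ cong (_+ suc q) (Σ𝓑≡ n m (suc q) 0 z≤n (lemma₁ m q) 1≤n) ⟩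
    ∑< m (λ j → n C (suc q + j)) + suc q       ≡⟨ +-comm _ (suc q) ⟩
    suc q + ∑< m (λ j → n C (suc q + j))
      ≤⟨ +-mono-≤ (≤-trans (a<[a+b]Ca q (suc (q + m)) (s≤s z≤n))
                    (≤-reflexive (cong₂ _C_ (lemma₂ m q) (sym (+-identityʳ q)))))
           (≤-reflexive (∑-cong (upTo m) λ {j} _ → cong (n C_) (sym (+-suc q j)))) ⟩
    n C (q + 0) + ∑< m (λ j → n C (q + suc j)) ≡⟨ ∑<-head m (λ j → n C (q + j)) ⟨
    ∑< (suc m) (λ j → n C (q + j))             ≡⟨ Σ𝓑≡ n (suc m) q 1 ≤-refl refl 1≤n ⟨
    Σ𝓑 n (suc m)                               ∎)
  where
  open ≤-Reasoning
  h = q + m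
  lemma₁ : ∀ m q → suc m + (q * 2 + 1) ≡ m + (suc q * 2 + 0)
  lemma₁ = solve-∀
  lemma₂ : ∀ m q → q + suc (q + m) ≡ m + (q * 2 + 1)
  lemma₂ = solve-∀
  lemma₃ : ∀ m q → m + (q * 2 + 1) + suc (suc m) ≡ suc (q + m) * 2 + 1
  lemma₃ = solve-∀
  lemma₄ : ∀ m q → m + (q * 2 + 1) + suc m ≡ suc (q + m) * 2 + 0
  lemma₄ = solve-∀
  D≤ : falling ((n + suc (suc m)) / 2) (suc m) ≤ suc q * falling ((n + suc m) / 2) m
  D≤ = ≤-reflexive (begin-equality
    falling ((n + suc (suc m)) / 2) (suc m)
      ≡⟨ cong (λ N → falling N (suc m)) (trans (cong (_/ 2) (lemma₃ m q)) ([q*2+e]/2≡q (suc h) ≤-refl)) ⟩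
    falling (suc h) m * (suc (q + m) ∸ m)     ≡⟨ cong (falling (suc h) m *_) (m+n∸n≡m (suc q) m) ⟩
    falling (suc h) m * suc q                 ≡⟨ *-comm (falling (suc h) m) (suc q) ⟩
    suc q * falling (suc h) m
      ≡⟨ cong (λ N → suc q * falling N m) (trans (cong (_/ 2) (lemma₄ m q)) ([q*2+e]/2≡q (suc h) z≤n)) ⟨
    suc q * falling ((n + suc m) / 2) m       ∎)
... | q , suc (suc _) , s≤s () , _

-- Removing the empty set

∣p∣≡0⇒p≡⊥ : (A : Subset n) → ∣ A ∣ ≡ 0 → A ≡ ⊥
∣p∣≡0⇒p≡⊥ Vec.[]            _    = refl
∣p∣≡0⇒p≡⊥ (false Vec.∷ A) ∣A∣≡0 = cong (outside Vec.∷_) (∣p∣≡0⇒p≡⊥ A ∣A∣≡0)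

⊥∉⇒nonspanning : ∀ {m} {F : List (Subset n)} → ⊥ ∉ F → ∀ {T : Vec (Subset n) (suc m)} → T ∈ chains (suc m) F → ¬ Spanning T
⊥∉⇒nonspanning {F = F} ⊥∉F {A Vec.∷ As} T∈ (∣A∣≡0 , _) =
  ⊥∉F (subst (_∈ F) (∣p∣≡0⇒p≡⊥ A ∣A∣≡0) (VAll.head (proj₁ (chains-∈⁻ _ F T∈))))

≢⊥⇒⊥⊂ : {A : Subset n} → A ≢ ⊥ → ⊥ ⊂ A
≢⊥⇒⊥⊂ {A = Vec.[]}          A≢⊥ = contradiction refl A≢⊥
≢⊥⇒⊥⊂ {A = true  Vec.∷ A}   _   = out⊂in ⊥⊆
≢⊥⇒⊥⊂ {A = false Vec.∷ A}   A≢⊥ = s⊂s (≢⊥⇒⊥⊂ (A≢⊥ ∘ cong (outside Vec.∷_)))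

remove-⊥ : List (Subset n) → List (Subset n)
remove-⊥ = filter (λ A → ¬? (A ≟ˢ ⊥))

length-remove-⊥ : ∀ {F : List (Subset n)} → Unique F → length F ≤ suc (length (remove-⊥ F))
length-remove-⊥ {F = F} uF = subst₂ _≤_ (∑-1 F) (∑-1 (⊥ ∷ remove-⊥ F)) (∑-⊆ (λ _ → 1) uF F⊆)
  where
  F⊆ : ∀ {A} → A ∈ F → A ∈ ⊥ ∷ remove-⊥ F
  F⊆ {A} A∈ with A ≟ˢ ⊥
  ... | yes refl = here refl
  ... | no  A≢⊥  = there (∈-filter⁺ (λ A → ¬? (A ≟ˢ ⊥)) A∈ A≢⊥)

-- The chains avoiding `⊥` and those obtained by putting `⊥` below a chain of the remaining sets are
-- distinct chains of `F`.
chains-remove-⊥ : ∀ {F : List (Subset n)} → Unique F → ⊥ ∈ F → ∀ m →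
  length (chains (suc m) (remove-⊥ F)) + length (chains m (remove-⊥ F)) ≤ length (chains (suc m) F)
chains-remove-⊥ {F = F} uF ⊥∈F m = begin
  length (chains (suc m) F′) + length (chains m F′)
    ≡⟨ cong₂ _+_ (∑-1 (chains (suc m) F′)) (trans (∑-map (⊥ Vec.∷_) (chains m F′) (λ _ → 1)) (∑-1 (chains m F′))) ⟨
  ∑ (chains (suc m) F′) (λ _ → 1) + ∑ (map (⊥ Vec.∷_) (chains m F′)) (λ _ → 1)
    ≡⟨ ∑-++ (chains (suc m) F′) (λ _ → 1) ⟨
  ∑ (chains (suc m) F′ ++ map (⊥ Vec.∷_) (chains m F′)) (λ _ → 1)
    ≤⟨ ∑-⊆ (λ _ → 1)
         (Unique.++⁺ (chains-Unique (suc m) uF′) (Unique.map⁺ Vec.∷-injectiveʳ (chains-Unique m uF′)) disjoint) ⊆chains ⟩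
  ∑ (chains (suc m) F) (λ _ → 1)
    ≡⟨ ∑-1 (chains (suc m) F) ⟩
  length (chains (suc m) F) ∎
  where
  open ≤-Reasoning
  F′ = remove-⊥ F
  uF′ : Unique F′
  uF′ = Unique.filter⁺ (λ A → ¬? (A ≟ˢ ⊥)) uF
  F′⇒ : ∀ {A} → A ∈ F′ → A ∈ F × A ≢ ⊥
  F′⇒ = ∈-filter⁻ (λ A → ¬? (A ≟ˢ ⊥)) {xs = F}
  disjoint : ∀ {T} → ¬ (T ∈ chains (suc m) F′ × T ∈ map (⊥ Vec.∷_) (chains m F′))
  disjoint (T∈ , T∈′) with ∈-map⁻ (⊥ Vec.∷_) T∈′
  ... | U , _ , refl = proj₂ (F′⇒ (VAll.head (proj₁ (chains-∈⁻ (suc m) F′ T∈)))) refl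
  ⊥∷-Linked : ∀ {k} {U : Vec (Subset _) k} → VAll.All (_∈ F′) U → VLinked.Linked _⊂_ U → VLinked.Linked _⊂_ (⊥ Vec.∷ U)
  ⊥∷-Linked []       _ = VLinked.[-]
  ⊥∷-Linked (B∈ ∷ _) l = ≢⊥⇒⊥⊂ (proj₂ (F′⇒ B∈)) VLinked.∷ l
  ⊆chains : ∀ {T} → T ∈ chains (suc m) F′ ++ map (⊥ Vec.∷_) (chains m F′) → T ∈ chains (suc m) F
  ⊆chains T∈ with ∈-++⁻ (chains (suc m) F′) T∈
  ... | inj₁ T∈′ with chains-∈⁻ (suc m) F′ T∈′
  ...   | T∈F′ , l = chains-∈⁺ (VAll.map (proj₁ ∘ F′⇒) T∈F′) l
  ⊆chains T∈ | inj₂ T∈′ with ∈-map⁻ (⊥ Vec.∷_) T∈′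
  ... | U , U∈ , refl with chains-∈⁻ m F′ U∈
  ...   | U∈F′ , l = chains-∈⁺ (⊥∈F ∷ VAll.map (proj₁ ∘ F′⇒) U∈F′) (⊥∷-Linked U∈F′ l)

supersaturation : ∀ n m y → 1 ≤ n → m ≤ suc n → {F : List (Subset n)} → Unique F →
  length F ≡ suc y + Σ𝓑 n m → suc y * falling ((n + suc m) / 2) m ≤ length (chains (suc m) F)
supersaturation n m y 1≤n m≤1+n {F} uF ∣F∣≡ = cases m m≤1+n ∣F∣≡
  where
  open ≤-Reasoning
  -- A lower bound on `length F` suffices here, since the claim is also applied to the family
  -- without `⊥`, for two chain lengths with surpluses `y` and `r`.
  direct : ∀ m y → m ≤ suc n → {F : List (Subset n)} → Unique F → (∀ {T} → T ∈ chains (suc m) F → ¬ Spanning T) →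
           y + Σ𝓑 n m ≤ length F → y * falling ((n + suc m) / 2) m ≤ length (chains (suc m) F)
  direct m y m≤1+n {F} uF ¬span ≤∣F∣ = +-cancelʳ-≤ (Σ𝓑 n m * D) _ _ (begin
    y * D + Σ𝓑 n m * D                           ≡⟨ *-distribʳ-+ D y (Σ𝓑 n m) ⟨
    (y + Σ𝓑 n m) * D                             ≤⟨ *-monoˡ-≤ D ≤∣F∣ ⟩
    length F * D                                 ≤⟨ nonspanning-supersaturation n m 1≤n m≤1+n uF ¬span ⟩
    length (chains (suc m) F) + Σ𝓑 n m * D       ∎)
    where D = falling ((n + suc m) / 2) m

  cases : ∀ m → m ≤ suc n → length F ≡ suc y + Σ𝓑 n m → suc y * falling ((n + suc m) / 2) m ≤ length (chains (suc m) F)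
  cases zero m≤1+n ∣F∣≡ = direct 0 (suc y) z≤n uF ¬span (≤-reflexive (sym ∣F∣≡))
    where
    ¬span : ∀ {T} → T ∈ chains 1 F → ¬ Spanning T
    ¬span {A Vec.∷ Vec.[]} _ (∣A∣≡0 , ∣A∣≡n) = <⇒≢ 1≤n (trans (sym ∣A∣≡0) ∣A∣≡n)
  cases (suc m) 1+m≤1+n ∣F∣≡ with member? _≟ˢ_ ⊥ F | m≤n⇒m<n∨m≡n (s≤s⁻¹ 1+m≤1+n)
  ... | no ⊥∉F  | _         = direct (suc m) (suc y) 1+m≤1+n uF (⊥∉⇒nonspanning ⊥∉F) (≤-reflexive (sym ∣F∣≡))
  -- Here the chains would have `n + 2` members, more than there are levels, so none can be
  -- spanning.
  ... | yes ⊥∈F | inj₂ refl = direct (suc m) (suc y) 1+m≤1+n uF ¬span (≤-reflexive (sym ∣F∣≡))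
    where
    ¬span : ∀ {T} → T ∈ chains (suc (suc m)) F → ¬ Spanning T
    ¬span {A Vec.∷ As} T∈ (_ , last≡n) = 1+n≰n (begin
      suc n                                 ≡⟨ length-sizes As ⟨
      length (sizes (toList As))            ≤⟨ m≤n+m _ ∣ A ∣ ⟩
      ∣ A ∣ + length (sizes (toList As))    ≤⟨ p+length≤lastOr (sizes-Linked (proj₂ (chains-∈⁻ (suc (suc m)) F T∈))) ⟩
      lastOr ∣ A ∣ (sizes (toList As))       ≡⟨ last≡n ⟩
      n                                     ∎)
  -- Without `⊥` the surplus drops from `suc y` to `y`. The missing summand `D` comes from the
  -- chains that are one set shorter, each extended by `⊥`.
  ... | yes ⊥∈F | inj₁ m<n with next-middle n m 1≤n m<n
  ...   | r , D≤ , Σ≤ = begin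
    D + y * D                                                        ≡⟨ +-comm D (y * D) ⟩
    y * D + D
      ≤⟨ +-mono-≤ (direct (suc m) y 1+m≤1+n uF′ (⊥∉⇒nonspanning ⊥∉F′) ≤∣F′∣)
           (≤-trans D≤ (direct m r (<⇒≤ (m≤n⇒m≤1+n m<n)) uF′ (⊥∉⇒nonspanning ⊥∉F′) r≤)) ⟩
    length (chains (suc (suc m)) F′) + length (chains (suc m) F′)    ≤⟨ chains-remove-⊥ uF ⊥∈F (suc m) ⟩
    length (chains (suc (suc m)) F)                                  ∎
    where
    D  = falling ((n + suc (suc m)) / 2) (suc m)
    F′ = remove-⊥ F
    uF′ : Unique F′
    uF′ = Unique.filter⁺ (λ A → ¬? (A ≟ˢ ⊥)) uF
    ⊥∉F′ : ⊥ ∉ F′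
    ⊥∉F′ ⊥∈F′ = proj₂ (∈-filter⁻ (λ A → ¬? (A ≟ˢ ⊥)) {xs = F} ⊥∈F′) refl
    ≤∣F′∣ : y + Σ𝓑 n (suc m) ≤ length F′
    ≤∣F′∣ = s≤s⁻¹ (≤-trans (≤-reflexive (sym ∣F∣≡)) (length-remove-⊥ uF))
    r≤ : r + Σ𝓑 n m ≤ length F′
    r≤ = begin
      r + Σ𝓑 n m          ≡⟨ +-comm r (Σ𝓑 n m) ⟩
      Σ𝓑 n m + r          ≤⟨ Σ≤ ⟩
      Σ𝓑 n (suc m)        ≤⟨ m≤n+m _ y ⟩
      y + Σ𝓑 n (suc m)    ≤⟨ ≤∣F′∣ ⟩
      length F′           ∎

-- From natural numbers to integers

∏≡falling : ∀ N j → ∏[1⋯ j ] (λ i → ℤ.+ N ℤ.- ℤ.+ i ℤ.+ ℤ.1ℤ) ≡ ℤ.+ falling N j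
∏≡falling N zero    = refl
∏≡falling N (suc j) with j ≤? N
... | yes j≤N = trans (cong₂ ℤ._*_ (∏≡falling N j) factor) (sym (ℤ.pos-* (falling N j) (N ∸ j)))
  where
  lemma : ∀ x y → x ℤ.- (ℤ.1ℤ ℤ.+ y) ℤ.+ ℤ.1ℤ ≡ x ℤ.- y
  lemma = ℤSolver.solve-∀
  factor : ℤ.+ N ℤ.- ℤ.+ suc j ℤ.+ ℤ.1ℤ ≡ ℤ.+ (N ∸ j)
  factor = trans (lemma (ℤ.+ N) (ℤ.+ j)) (trans (ℤ.m-n≡m⊖n N j) (ℤ.⊖-≥ j≤N))
-- Beyond `N` the integer factors are negative while those of `falling` are truncated, but both
-- products already contain the factor 0.
... | no  j≰N = trans (cong (ℤ._* (ℤ.+ N ℤ.- ℤ.+ suc j ℤ.+ ℤ.1ℤ)) (trans (∏≡falling N j) (cong ℤ.+_ (falling≡0 (≰⇒> j≰N)))))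
                      (cong ℤ.+_ (sym (falling≡0 (m≤n⇒m≤1+n (≰⇒> j≰N)))))

open import Data.Integer.Base using (ℤ; +_)

theorem1p2 : ∀ (n k : ℕ) → 1 ≤ n → 1 ≤ k → (x : ℤ) →
    (F : List (Subset n)) → Unique F →
    + length F ≡ x ℤ.+ + Σ𝓑 n (k ∸ 1) →
    x ℤ.* ∏[1⋯ k ∸ 1 ] (λ i → + ((n + k) / 2) ℤ.- + i ℤ.+ ℤ.1ℤ) ℤ.≤ + length (chains k F)
theorem1p2 n (suc m) 1≤n _ x F uF ∣F∣≡ =
  subst (λ P → x ℤ.* P ℤ.≤ + length (chains (suc m) F)) (sym (∏≡falling ((n + suc m) / 2) m)) (bound x ∣F∣≡)
  where
  D = falling ((n + suc m) / 2) m
  bound : ∀ x → + length F ≡ x ℤ.+ + Σ𝓑 n m → x ℤ.* + D ℤ.≤ + length (chains (suc m) F)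
  -- For nonpositive `x` the left side is at most 0, because the product is the natural number `D`.
  bound ℤ.-[1+ y ] _    = ℤ.≤-trans (ℤ.*-monoʳ-≤-nonNeg (+ D) {ℤ.-[1+ y ]} {+ 0} ℤ.-≤+) (ℤ.+≤+ z≤n)
  bound (+ zero)   _    = ℤ.+≤+ z≤n
  bound (+ suc y)  ∣F∣≡ with m ≤? suc n
  ... | yes m≤1+n = subst (ℤ._≤ + length (chains (suc m) F)) (ℤ.pos-* (suc y) D)
                      (ℤ.+≤+ (supersaturation n m y 1≤n m≤1+n uF (ℤ.+-injective ∣F∣≡)))
  -- Once `m` exceeds `n + 1`, half of `n + suc m` rounds down below `m`, so the product contains a
  -- zero factor.
  ... | no  m≰1+n = subst (λ z → + suc y ℤ.* + z ℤ.≤ + length (chains (suc m) F)) (sym (falling≡0 N<m))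
                      (subst (ℤ._≤ + length (chains (suc m) F)) (sym (ℤ.*-zeroʳ (+ suc y))) (ℤ.+≤+ z≤n))
    where
    open ≤-Reasoning
    N<m : (n + suc m) / 2 < m
    N<m = ≤-trans (s≤s (m≤n*2+1⇒m/2≤n {n = pred m} (begin
      n + suc m           ≡⟨ +-suc n m ⟩
      suc n + m           ≤⟨ +-monoˡ-≤ m (<⇒≤pred (≰⇒> m≰1+n)) ⟩
      pred m + m          ≡⟨ cong (λ z → pred m + z) (suc-pred m) ⟨
      pred m + suc (pred m)  ≡⟨ lemma (pred m) ⟩
      pred m * 2 + 1      ∎))) (≤-reflexive (suc-pred m))
      where
      instance
        _ : NonZero m
        _ = >-nonZero (≤-trans (s≤s z≤n) (≰⇒> m≰1+n))
      lemma : ∀ p → p + suc p ≡ p * 2 + 1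
      lemma = solve-∀
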